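{- For $1\le i\le k$ let $D_i$ be defined on left $\mathcal A_\hbar[x_1,\dots,x_n]$-linear combinations of the $\overline T_\nu$ ($\nu\subseteq(n-k)^k$) by $D_i(g\overline T_\mu)=gD_i(\overline T_\mu)$ and $$D_i(\overline T_\mu)=x_{\mu_i+k+1-i}\,\overline T_\mu+\sum_\lambda\bigl(\hbar-(p-q)x_{\mathtt h(\mu/\lambda)}\bigr)p^{\operatorname{ht}(\mu/\lambda)-1}q^{\operatorname{wd}(\mu/\lambda)-1}\,\overline T_\lambda,$$ the sum over $\lambda\subseteq(n-k)^k$ with $\mu/\lambda$ a ribbon whose head is in row $i$. Then for $\mu\subseteq(n-k)^k$ and any subset $\{i_1<\cdots<i_r\}\subseteq\{1,\dots,k\}$, $$\overline T_{w_\mu}\,x_{i_1}\cdots x_{i_r}\,\Sigma^n_k=D_{k+1-i_r}\bigl(\cdots D_{k+1-i_2}(D_{k+1-i_1}(\overline T_\mu))\cdots\bigr).$$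
   Context: $\mathcal A_\hbar=\mathbb Q[p,q,\hbar]$; $\widehat H_n$ is generated by $T_1,\dots,T_{n-1},x_1,\dots,x_n$ with $(T_i+p)(T_i-q)=0$, braid relations, $x_ix_j=x_jx_i$, $T_ix_j=x_jT_i$ ($j\ne i,i+1$), $T_ix_i=x_{i+1}T_i+(\hbar-(p-q)x_i)$, $T_ix_{i+1}=x_iT_i-(\hbar-(p-q)x_i)$. $\overline T_i=T_i+p-q$, $\overline T_w$ via reduced words. For $\nu\subseteq(n-k)^k$, $w_\nu$ has $w_\nu(k+1-i)=\nu_i+k+1-i$ ($1\le i\le k$), increasing on $\{k+1,\dots,n\}$. $[m]=(p^m-q^m)/(p-q)$, $[m]!=\prod_{j\le m}[j]$, $d=\binom k2+\binom{n-k}2$, $\Sigma^n_k=\frac1{[k]![n-k]!}\sum_{v\in S_k\times S_{n-k}}q^{d-\ell(v)}\overline T_v$ (scalars extended to invert $[k]![n-k]!$), $\overline T_\nu=\overline T_{w_\nu}\Sigma^n_k$. Ribbon: nonempty connected skew shape with no $2\times2$ square; head = top-right box; $\operatorname{ht},\operatorname{wd}$ = numbers of rows/columns; head in row $i$ gives $\mathtt h(\mu/\lambda)=\mu_i+k+1-i$. -}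

module Defs where

open import Level using (0ℓ)
open import Algebra.Bundles using (Ring; CommutativeRing)
open import Data.Nat.Base as ℕ using (ℕ; zero; suc; _∸_; ∣_-_∣)
import Data.Nat.Properties as ℕ
open import Data.Nat.Combinatorics using (_C_)
open import Data.Rational.Properties using () renaming (+-*-commutativeRing to ℚ-commutativeRing)
open import Data.Fin.Base as Fin using (Fin; zero; suc; toℕ; inject₁; fromℕ; fromℕ<; opposite; punchIn; _↑ˡ_; _↑ʳ_)
import Data.Fin.Properties as Fin
open import Data.Fin.Permutation using (Permutation′; _⟨$⟩ʳ_; _∘ₚ_; transpose; insert; remove; lift₀; lift₀-transpose; insert-punchIn; punchIn-permute) renaming (id to idₚ; _≈_ to _≈ₚ_)
open import Data.List.Base using (List; []; _∷_; _++_; [_]; map; foldr; length; filter; concatMap; allFin; cartesianProduct; cartesianProductWith)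
import Data.List.Properties as List
open import Data.List.Membership.Propositional using (_∈_)
import Data.List.Membership.Propositional.Properties as ∈
open import Data.List.Relation.Unary.Any as Any using (Any; here; there)
import Data.List.Relation.Unary.Any.Properties as Any
open import Data.List.Relation.Unary.All as All using (All; []; _∷_)
import Data.List.Relation.Unary.All.Properties as All
open import Data.List.Relation.Unary.AllPairs as AllPairs using (AllPairs; []; _∷_)
import Data.List.Relation.Unary.AllPairs.Properties as AllPairs
open import Data.List.Relation.Unary.Unique.Propositional using (Unique)
import Data.List.Relation.Unary.Unique.Propositional.Properties as Unique
import Data.List.Relation.Unary.Unique.Setoid.Properties as Uniqueₛ
open import Data.Product.Base using (∃; _×_; _,_; proj₁; proj₂)
import Data.Product.Properties as Product
open import Data.Sum.Base using (_⊎_; inj₁; inj₂)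
open import Data.Sum.Function.Propositional using (_⊎-↔_)
open import Data.Unit.Base using (⊤; tt)
open import Function.Base using (_∘_; case_of_)
open import Function.Properties.Inverse using (↔-sym; ↔-trans)
open import Relation.Binary.Bundles using (Setoid)
open import Relation.Binary.Core using (Rel)
open import Relation.Binary.Definitions using (DecidableEquality; Decidable)
open import Relation.Binary.Construct.Closure.ReflexiveTransitive using (Star; ε; _◅_; _◅◅_)
open import Relation.Binary.PropositionalEquality as ≡ using (_≡_; _≢_; cong; cong₂)
open import Relation.Nullary using (¬_; Dec; yes; no)
open import Relation.Nullary.Negation using (contradiction)
open import Relation.Nullary.Decidable using (map′; _×-dec_; _⊎-dec_; _→-dec_; ¬?)

module Presented (R : CommutativeRing 0ℓ 0ℓ) (X : Set) where

  private module R = CommutativeRing R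

  infixl 6 _⊕_
  infixl 7 _⊗_

  data Term : Set where
    con     : R.Carrier → Term
    var     : X → Term
    _⊕_ _⊗_ : Term → Term → Term
    ⊝_      : Term → Term

  -- The congruence generated by _~_, the axioms of associative unital
  -- R-algebras and the requirement that con is the structure map.
  data Congruence (_~_ : Rel Term 0ℓ) : Rel Term 0ℓ where
    relation   : ∀ {s t} → s ~ t → Congruence _~_ s t
    refl       : ∀ {s} → Congruence _~_ s s
    sym        : ∀ {s t} → Congruence _~_ s t → Congruence _~_ t s
    trans      : ∀ {s t u} → Congruence _~_ s t → Congruence _~_ t u → Congruence _~_ s u
    ⊕-cong     : ∀ {s s′ t t′} → Congruence _~_ s s′ → Congruence _~_ t t′ → Congruence _~_ (s ⊕ t) (s′ ⊕ t′)
    ⊗-cong     : ∀ {s s′ t t′} → Congruence _~_ s s′ → Congruence _~_ t t′ → Congruence _~_ (s ⊗ t) (s′ ⊗ t′)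
    ⊝-cong     : ∀ {s s′} → Congruence _~_ s s′ → Congruence _~_ (⊝ s) (⊝ s′)
    ⊕-assoc    : ∀ s t u → Congruence _~_ ((s ⊕ t) ⊕ u) (s ⊕ (t ⊕ u))
    ⊕-comm     : ∀ s t → Congruence _~_ (s ⊕ t) (t ⊕ s)
    ⊕-identity : ∀ s → Congruence _~_ (con R.0# ⊕ s) s
    ⊕-inverse  : ∀ s → Congruence _~_ (⊝ s ⊕ s) (con R.0#)
    ⊗-assoc    : ∀ s t u → Congruence _~_ ((s ⊗ t) ⊗ u) (s ⊗ (t ⊗ u))
    ⊗-identity : ∀ s → Congruence _~_ (con R.1# ⊗ s) s
    distribˡ   : ∀ s t u → Congruence _~_ (s ⊗ (t ⊕ u)) ((s ⊗ t) ⊕ (s ⊗ u))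
    distribʳ   : ∀ s t u → Congruence _~_ ((t ⊕ u) ⊗ s) ((t ⊗ s) ⊕ (u ⊗ s))
    con-cong   : ∀ {a b} → a R.≈ b → Congruence _~_ (con a) (con b)
    con-+      : ∀ a b → Congruence _~_ (con (a R.+ b)) (con a ⊕ con b)
    con-*      : ∀ a b → Congruence _~_ (con (a R.* b)) (con a ⊗ con b)
    con-central : ∀ a s → Congruence _~_ (con a ⊗ s) (s ⊗ con a)

  algebra : Rel Term 0ℓ → Ring 0ℓ 0ℓ
  algebra _~_ = record
    { Carrier = Term
    ; _≈_ = Congruence _~_
    ; _+_ = _⊕_
    ; _*_ = _⊗_
    ; -_  = ⊝_
    ; 0#  = con R.0#
    ; 1#  = con R.1#
    ; isRing = record
      { +-isAbelianGroup = record
        { isGroup = record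
          { isMonoid = record
            { isSemigroup = record
              { isMagma = record
                { isEquivalence = record { refl = refl ; sym = sym ; trans = trans }
                ; ∙-cong = ⊕-cong
                }
              ; assoc = ⊕-assoc
              }
            ; identity = ⊕-identity , λ s → trans (⊕-comm s _) (⊕-identity s)
            }
          ; inverse = ⊕-inverse , λ s → trans (⊕-comm s _) (⊕-inverse s)
          ; ⁻¹-cong = ⊝-cong
          }
        ; comm = ⊕-comm
        }
      ; *-cong = ⊗-cong
      ; *-assoc = ⊗-assoc
      ; *-identity = ⊗-identity , λ s → trans (sym (con-central R.1# s)) (⊗-identity s)
      ; distrib = distribˡ , distribʳ
      }
    }

  data Commuting (_~_ : Rel Term 0ℓ) : Rel Term 0ℓ where
    given    : ∀ {s t} → s ~ t → Commuting _~_ s t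
    commutes : ∀ s t → Commuting _~_ (s ⊗ t) (t ⊗ s)

  commutativeAlgebra : Rel Term 0ℓ → CommutativeRing 0ℓ 0ℓ
  commutativeAlgebra _~_ = record
    { isCommutativeRing = record
      { isRing = Ring.isRing (algebra (Commuting _~_))
      ; *-comm = λ s t → relation (commutes s t)
      }
    }

data NoRelation {A : Set} : Rel A 0ℓ where

polynomialRing : CommutativeRing 0ℓ 0ℓ → Set → CommutativeRing 0ℓ 0ℓ
polynomialRing R X = Presented.commutativeAlgebra R X NoRelation

module Localization (R : CommutativeRing 0ℓ 0ℓ) (s : CommutativeRing.Carrier R) where

  open Presented R ⊤ public

  data Inverts : Rel Term 0ℓ where
    inverts : Inverts (con s ⊗ var tt) (con (CommutativeRing.1# R))

  -- R[1/s], as R[y]/(s y - 1)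
  R[1/s] : CommutativeRing 0ℓ 0ℓ
  R[1/s] = commutativeAlgebra Inverts

  1/s : Term
  1/s = var tt

module RingOps (R : Ring 0ℓ 0ℓ) where
  open Ring R public
  open import Algebra.Properties.Semiring.Exp semiring public using (_^_)

  ∑ ∏ : List Carrier → Carrier
  ∑ = foldr _+_ 0#
  ∏ = foldr _*_ 1#

data Parameter : Set where
  `p `q `ħ : Parameter

𝒜ħ : CommutativeRing 0ℓ 0ℓ
𝒜ħ = polynomialRing ℚ-commutativeRing Parameter

module Scalars where
  open RingOps (CommutativeRing.ring 𝒜ħ) public
  open Presented ℚ-commutativeRing Parameter public using (var)

  p q ħ : Carrier
  p = var `p
  q = var `q
  ħ = var `ħ

  -- The quotient (p^m - q^m)/(p - q), written out as the polynomial
  -- p^(m-1) + p^(m-2) q + ⋯ + q^(m-1); see quantum-integer below.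
  [[_]] : ℕ → Carrier
  [[ zero ]]  = 0#
  [[ suc m ]] = p ^ m + q * [[ m ]]

  [[_]]! : ℕ → Carrier
  [[ zero ]]!  = 1#
  [[ suc m ]]! = [[ suc m ]] * [[ m ]]!

  quantum-integer : ∀ m → (p - q) * [[ m ]] ≈ p ^ m - q ^ m
  quantum-integer zero    = trans (zeroʳ _) (sym (-‿inverseʳ 1#))
  quantum-integer (suc m) = begin
    (p - q) * (p ^ m + q * [[ m ]])                     ≈⟨ distribˡ _ _ _ ⟩
    (p - q) * p ^ m + (p - q) * (q * [[ m ]])           ≈⟨ +-cong (distribʳ _ _ _) (x∙yz≈y∙xz _ _ _) ⟩
    (p * p ^ m + - q * p ^ m) + q * ((p - q) * [[ m ]]) ≈⟨ +-congˡ (*-congˡ (quantum-integer m)) ⟩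
    (p * p ^ m + - q * p ^ m) + q * (p ^ m - q ^ m)     ≈⟨ +-congˡ (distribˡ _ _ _) ⟩
    (p * p ^ m + - q * p ^ m) + (q * p ^ m + q * - q ^ m) ≈⟨ +-assoc _ _ _ ⟩
    p * p ^ m + (- q * p ^ m + (q * p ^ m + q * - q ^ m)) ≈⟨ +-congˡ (sym (+-assoc _ _ _)) ⟩
    p * p ^ m + ((- q * p ^ m + q * p ^ m) + q * - q ^ m) ≈⟨ +-congˡ (+-congʳ (sym (distribʳ _ _ _))) ⟩
    p * p ^ m + ((- q + q) * p ^ m + q * - q ^ m)       ≈⟨ +-congˡ (+-congʳ (*-congʳ (-‿inverseˡ q))) ⟩
    p * p ^ m + (0# * p ^ m + q * - q ^ m)              ≈⟨ +-congˡ (+-congʳ (zeroˡ _)) ⟩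
    p * p ^ m + (0# + q * - q ^ m)                      ≈⟨ +-congˡ (+-identityˡ _) ⟩
    p * p ^ m + q * - q ^ m                             ≈⟨ +-congˡ (sym (-‿distribʳ-* _ _)) ⟩
    p * p ^ m - q * q ^ m                               ≈⟨ +-cong (^-suc p m) (-‿cong (^-suc q m)) ⟩
    p ^ suc m - q ^ suc m ∎
    where
    open import Relation.Binary.Reasoning.Setoid setoid
    open import Algebra.Properties.Ring (CommutativeRing.ring 𝒜ħ) using (-‿distribʳ-*)
    open import Algebra.Properties.CommutativeSemigroup (CommutativeRing.*-commutativeSemigroup 𝒜ħ) using (x∙yz≈y∙xz)
    ^-suc : ∀ a k → a * a ^ k ≈ a ^ suc k
    ^-suc a zero    = refl
    ^-suc a (suc k) = refl

-- Indices are 0-based throughout.  Simple n has n - 1 elements, indexing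
-- T₁, …, Tₙ₋₁; Tᵢ involves the positions lo i and hi i, i.e. i and i+1.

data Simple : ℕ → Set where
  zero : ∀ {n} → Simple (suc (suc n))
  suc  : ∀ {n} → Simple n → Simple (suc n)

lo hi : ∀ {n} → Simple n → Fin n
lo zero    = zero
lo (suc i) = suc (lo i)
hi zero    = suc zero
hi (suc i) = suc (hi i)

module Hecke (R : CommutativeRing 0ℓ 0ℓ) (p q ħ : CommutativeRing.Carrier R) (n : ℕ) where

  data Generator : Set where
    `T : Simple n → Generator
    `x : Fin n → Generator

  open Presented R Generator public

  private
    infixl 6 _⊖_
    _⊖_ : Term → Term → Term
    s ⊖ t = s ⊕ ⊝ t

  T : Simple n → Term
  T i = var (`T i)

  x : Fin n → Term
  x j = var (`x j)

  ħ-[p-q]x : Fin n → Term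
  ħ-[p-q]x j = con ħ ⊖ (con p ⊖ con q) ⊗ x j

  data Relation : Rel Term 0ℓ where
    quadratic : ∀ i → Relation ((T i ⊕ con p) ⊗ (T i ⊖ con q)) (con (CommutativeRing.0# R))
    braid     : ∀ i j → lo j ≡ hi i → Relation (T i ⊗ T j ⊗ T i) (T j ⊗ T i ⊗ T j)
    far       : ∀ i j → hi i Fin.< lo j → Relation (T i ⊗ T j) (T j ⊗ T i)
    x-comm    : ∀ i j → Relation (x i ⊗ x j) (x j ⊗ x i)
    T-x       : ∀ i j → j ≢ lo i → j ≢ hi i → Relation (T i ⊗ x j) (x j ⊗ T i)
    T-x-lo    : ∀ i → Relation (T i ⊗ x (lo i)) (x (hi i) ⊗ T i ⊕ ħ-[p-q]x (lo i))
    T-x-hi    : ∀ i → Relation (T i ⊗ x (hi i)) (x (lo i) ⊗ T i ⊖ ħ-[p-q]x (lo i))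

  Ĥ : Ring 0ℓ 0ℓ
  Ĥ = algebra Relation

  T̄ : Simple n → Term
  T̄ i = T i ⊕ con p ⊖ con q

Word : ℕ → Set
Word n = List (Simple n)

s : ∀ {n} → Simple n → Permutation′ n
s i = transpose (lo i) (hi i)

-- ⟪ a₁ ∷ ⋯ ∷ aₗ ∷ [] ⟫ is the composite function s a₁ ∘ ⋯ ∘ s aₗ
-- (the library's _∘ₚ_ applies its left argument first).
⟪_⟫ : ∀ {n} → Word n → Permutation′ n
⟪ [] ⟫     = idₚ
⟪ a ∷ as ⟫ = ⟪ as ⟫ ∘ₚ s a

record ReducedWord {n : ℕ} (π : Permutation′ n) : Set where
  field
    letters : Word n
    spells  : ⟪ letters ⟫ ≈ₚ π
    minimal : ∀ (as : Word n) → ⟪ as ⟫ ≈ₚ π → length letters ℕ.≤ length as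

-- The word s_j ⋯ s_2 s_1 (1-based), sending 0 to j and preserving the
-- order of the other points (0-based).
descend : ∀ {n} → Fin (suc n) → Word (suc n)
descend         zero    = []
descend {suc n} (suc j) = map suc (descend j) ++ [ zero ]

-- With j the first value of π and π′ the permutation left after removing
-- it, π = (s_j ⋯ s_1) · (1 × π′) with j 0-based and lengths adding up.
word : ∀ {n} → Permutation′ n → Word n
word {zero}  π = []
word {suc n} π = descend (π ⟨$⟩ʳ zero) ++ map suc (word (remove zero π))

private
  ⟪++⟫ : ∀ {n} (as bs : Word n) i → ⟪ as ++ bs ⟫ ⟨$⟩ʳ i ≡ ⟪ as ⟫ ⟨$⟩ʳ (⟪ bs ⟫ ⟨$⟩ʳ i)
  ⟪++⟫ []       bs i = ≡.refl
  ⟪++⟫ (a ∷ as) bs i = cong (s a ⟨$⟩ʳ_) (⟪++⟫ as bs i)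

  s-suc : ∀ {n} (a : Simple n) → s (suc a) ≈ₚ lift₀ (s a)
  s-suc a = lift₀-transpose (lo a) (hi a)

  ⟪map-suc⟫ : ∀ {n} (as : Word n) → ⟪ map suc as ⟫ ≈ₚ lift₀ ⟪ as ⟫
  ⟪map-suc⟫ []       zero    = ≡.refl
  ⟪map-suc⟫ []       (suc i) = ≡.refl
  ⟪map-suc⟫ (a ∷ as) zero    = ≡.trans (cong (s (suc a) ⟨$⟩ʳ_) (⟪map-suc⟫ as zero)) (s-suc a zero)
  ⟪map-suc⟫ (a ∷ as) (suc i) = ≡.trans (cong (s (suc a) ⟨$⟩ʳ_) (⟪map-suc⟫ as (suc i))) (s-suc a (suc (⟪ as ⟫ ⟨$⟩ʳ i)))

  descend-zero : ∀ {n} (j : Fin (suc n)) → ⟪ descend j ⟫ ⟨$⟩ʳ zero ≡ j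
  descend-zero zero = ≡.refl
  descend-zero {suc n} (suc j) =
    ≡.trans (⟪++⟫ (map suc (descend j)) [ zero ] zero)
    (≡.trans (⟪map-suc⟫ (descend j) (suc zero))
    (cong suc (descend-zero j)))

  descend-suc : ∀ {n} (j : Fin (suc n)) i → ⟪ descend j ⟫ ⟨$⟩ʳ suc i ≡ punchIn j i
  descend-suc zero i = ≡.refl
  descend-suc {suc n} (suc j) zero =
    ≡.trans (⟪++⟫ (map suc (descend j)) [ zero ] (suc zero))
    (⟪map-suc⟫ (descend j) zero)
  descend-suc {suc n} (suc j) (suc i) =
    ≡.trans (⟪++⟫ (map suc (descend j)) [ zero ] (suc (suc i)))
    (≡.trans (⟪map-suc⟫ (descend j) (suc (suc i)))
    (cong suc (descend-suc j i)))

  length-descend : ∀ {n} (j : Fin (suc n)) → length (descend j) ≡ toℕ j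
  length-descend zero = ≡.refl
  length-descend {suc n} (suc j) =
    ≡.trans (List.length-++ (map suc (descend j)))
    (≡.trans (ℕ.+-comm _ 1) (cong suc (≡.trans (List.length-map suc (descend j)) (length-descend j))))

word-spells : ∀ {n} (π : Permutation′ n) → ⟪ word π ⟫ ≈ₚ π
word-spells {suc n} π i =
  ≡.trans (⟪++⟫ (descend (π ⟨$⟩ʳ zero)) _ i)
  (≡.trans (cong (⟪ descend (π ⟨$⟩ʳ zero) ⟫ ⟨$⟩ʳ_) (⟪map-suc⟫ (word (remove zero π)) i)) (go i))
  where
  go : ∀ i → ⟪ descend (π ⟨$⟩ʳ zero) ⟫ ⟨$⟩ʳ (lift₀ ⟪ word (remove zero π) ⟫ ⟨$⟩ʳ i) ≡ π ⟨$⟩ʳ i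
  go zero    = descend-zero _
  go (suc i) =
    ≡.trans (descend-suc _ _)
    (≡.trans (cong (punchIn _) (word-spells (remove zero π) i)) (≡.sym (punchIn-permute π zero i)))

private
  len : ∀ {n} → Permutation′ n → ℕ
  len π = length (word π)

  len-suc : ∀ {n} (π : Permutation′ (suc n)) → len π ≡ toℕ (π ⟨$⟩ʳ zero) ℕ.+ len (remove zero π)
  len-suc π =
    ≡.trans (List.length-++ (descend (π ⟨$⟩ʳ zero)))
    (cong₂ ℕ._+_ (length-descend (π ⟨$⟩ʳ zero)) (List.length-map suc (word (remove zero π))))

  remove-≈ : ∀ {n} (π : Permutation′ (suc n)) (σ : Permutation′ n) →
             (∀ i → π ⟨$⟩ʳ suc i ≡ punchIn (π ⟨$⟩ʳ zero) (σ ⟨$⟩ʳ i)) → remove zero π ≈ₚ σ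
  remove-≈ π σ h i = Fin.punchIn-injective (π ⟨$⟩ʳ zero) _ _ (≡.trans (≡.sym (punchIn-permute π zero i)) (h i))

  word-cong : ∀ {n} (π ρ : Permutation′ n) → π ≈ₚ ρ → word π ≡ word ρ
  word-cong {zero}  π ρ π≈ρ = ≡.refl
  word-cong {suc n} π ρ π≈ρ =
    cong₂ (λ j as → descend j ++ map suc as) (π≈ρ zero)
      (word-cong (remove zero π) (remove zero ρ) (remove-≈ π (remove zero ρ) λ i →
        ≡.trans (π≈ρ (suc i)) (≡.trans (punchIn-permute ρ zero i)
          (cong (λ j → punchIn j (remove zero ρ ⟨$⟩ʳ i)) (≡.sym (π≈ρ zero))))))

  Moves Fixes : ∀ {n} (a : Simple (suc n)) (j : Fin (suc n)) → Set
  Moves a j     = toℕ (s a ⟨$⟩ʳ j) ℕ.≤ suc (toℕ j)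
                × (∀ i → s a ⟨$⟩ʳ punchIn j i ≡ punchIn (s a ⟨$⟩ʳ j) i)
  Fixes {n} a j = s a ⟨$⟩ʳ j ≡ j
                × ∃ λ (b : Simple n) → ∀ i → s a ⟨$⟩ʳ punchIn j i ≡ punchIn j (s b ⟨$⟩ʳ i)

  moves-or-fixes : ∀ {n} (a : Simple (suc n)) (j : Fin (suc n)) → Moves a j ⊎ Fixes a j
  moves-or-fixes zero zero = inj₁ (ℕ.≤-refl , λ { zero → ≡.refl ; (suc i) → ≡.refl })
  moves-or-fixes zero (suc zero) = inj₁ (ℕ.z≤n , λ { zero → ≡.refl ; (suc i) → ≡.refl })
  moves-or-fixes {suc (suc n)} zero (suc (suc j)) =
    inj₂ (≡.refl , zero , λ { zero → ≡.refl ; (suc zero) → ≡.refl ; (suc (suc i)) → ≡.refl })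
  moves-or-fixes (suc a) zero = inj₂ (≡.refl , a , λ i → s-suc a (suc i))
  moves-or-fixes {suc n} (suc a) (suc j) with moves-or-fixes a j
  ... | inj₁ (le , eq) = inj₁
    ( ≡.subst (λ t → toℕ t ℕ.≤ suc (suc (toℕ j))) (≡.sym sj) (ℕ.s≤s le)
    , λ { zero → ≡.trans (s-suc a zero) (cong (λ t → punchIn t zero) (≡.sym sj))
        ; (suc i) → ≡.trans (s-suc a (suc (punchIn j i))) (≡.trans (cong suc (eq i)) (cong (λ t → punchIn t (suc i)) (≡.sym sj))) })
    where
    sj : s (suc a) ⟨$⟩ʳ suc j ≡ suc (s a ⟨$⟩ʳ j)
    sj = s-suc a (suc j)
  ... | inj₂ (fix , b , eq) = inj₂
    ( ≡.trans (s-suc a (suc j)) (cong suc fix)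
    , suc b
    , λ { zero → ≡.trans (s-suc a zero) (cong (punchIn (suc j)) (≡.sym (s-suc b zero)))
        ; (suc i) → ≡.trans (s-suc a (suc (punchIn j i))) (≡.trans (cong suc (eq i)) (cong (punchIn (suc j)) (≡.sym (s-suc b (suc i))))) })

  len-s : ∀ {n} (π : Permutation′ n) (a : Simple n) → len (π ∘ₚ s a) ℕ.≤ suc (len π)
  len-s {suc n} π a = case moves-or-fixes a (π ⟨$⟩ʳ zero) of λ
    { (inj₁ h) → moves h ; (inj₂ h) → fixes h }
    where
    open ℕ.≤-Reasoning
    π′ : Permutation′ (suc n)
    π′ = π ∘ₚ s a
    ρ : Permutation′ n
    ρ = remove zero π

    moves : Moves a (π ⟨$⟩ʳ zero) → len π′ ℕ.≤ suc (len π)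
    moves (le , eq) = begin
      len π′                                      ≡⟨ len-suc π′ ⟩
      toℕ (π′ ⟨$⟩ʳ zero) ℕ.+ len (remove zero π′)  ≡⟨ cong (λ as → toℕ (π′ ⟨$⟩ʳ zero) ℕ.+ length as) (word-cong (remove zero π′) ρ same) ⟩
      toℕ (π′ ⟨$⟩ʳ zero) ℕ.+ len ρ                 ≤⟨ ℕ.+-monoˡ-≤ (len ρ) le ⟩
      suc (toℕ (π ⟨$⟩ʳ zero) ℕ.+ len ρ)            ≡⟨ cong suc (len-suc π) ⟨
      suc (len π) ∎
      where
      same : remove zero π′ ≈ₚ ρ
      same = remove-≈ π′ ρ λ i → ≡.trans (cong (s a ⟨$⟩ʳ_) (punchIn-permute π zero i)) (eq (ρ ⟨$⟩ʳ i))

    fixes : Fixes a (π ⟨$⟩ʳ zero) → len π′ ℕ.≤ suc (len π)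
    fixes (fix , b , eq) = begin
      len π′                                      ≡⟨ len-suc π′ ⟩
      toℕ (π′ ⟨$⟩ʳ zero) ℕ.+ len (remove zero π′)  ≡⟨ cong₂ (λ j as → toℕ j ℕ.+ length as) fix (word-cong (remove zero π′) (ρ ∘ₚ s b) same) ⟩
      toℕ (π ⟨$⟩ʳ zero) ℕ.+ len (ρ ∘ₚ s b)         ≤⟨ ℕ.+-monoʳ-≤ (toℕ (π ⟨$⟩ʳ zero)) (len-s ρ b) ⟩
      toℕ (π ⟨$⟩ʳ zero) ℕ.+ suc (len ρ)            ≡⟨ ℕ.+-suc (toℕ (π ⟨$⟩ʳ zero)) (len ρ) ⟩
      suc (toℕ (π ⟨$⟩ʳ zero) ℕ.+ len ρ)            ≡⟨ cong suc (len-suc π) ⟨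
      suc (len π) ∎
      where
      same : remove zero π′ ≈ₚ (ρ ∘ₚ s b)
      same = remove-≈ π′ (ρ ∘ₚ s b) λ i →
        ≡.trans (cong (s a ⟨$⟩ʳ_) (punchIn-permute π zero i))
        (≡.trans (eq (ρ ⟨$⟩ʳ i)) (cong (λ j → punchIn j (s b ⟨$⟩ʳ (ρ ⟨$⟩ʳ i))) (≡.sym fix)))

  len-id : ∀ n → len (idₚ {n}) ≡ 0
  len-id zero    = ≡.refl
  len-id (suc n) = ≡.trans (len-suc (idₚ {suc n}))
    (≡.trans (cong length (word-cong (remove zero (idₚ {suc n})) idₚ (λ _ → ≡.refl))) (len-id n))

  len-⟪⟫ : ∀ {n} (as : Word n) → len ⟪ as ⟫ ℕ.≤ length as
  len-⟪⟫ {n} []   = ℕ.≤-reflexive (len-id n)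
  len-⟪⟫ (a ∷ as) = ℕ.≤-trans (len-s ⟪ as ⟫ a) (ℕ.s≤s (len-⟪⟫ as))

reducedWord : ∀ {n} (π : Permutation′ n) → ReducedWord π
reducedWord π = record
  { letters = word π
  ; spells  = word-spells π
  ; minimal = λ as as≈π → ≡.subst (λ bs → length bs ℕ.≤ length as) (word-cong _ _ as≈π) (len-⟪⟫ as)
  }

ℓ : ∀ {n} → Permutation′ n → ℕ
ℓ π = length (ReducedWord.letters (reducedWord π))

permutations : ∀ n → List (Permutation′ n)
permutations zero    = [ idₚ ]
permutations (suc n) = cartesianProductWith (insert zero) (allFin (suc n)) (permutations n)

permutationSetoid : ℕ → Setoid 0ℓ 0ℓ
permutationSetoid n = record
  { Carrier = Permutation′ n
  ; _≈_ = _≈ₚ_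
  ; isEquivalence = record
    { refl  = λ _ → ≡.refl
    ; sym   = λ e i → ≡.sym (e i)
    ; trans = λ e f i → ≡.trans (e i) (f i)
    }
  }

permutations-complete : ∀ {n} (π : Permutation′ n) → Any (π ≈ₚ_) (permutations n)
permutations-complete {zero}  π = here λ ()
permutations-complete {suc n} π =
  Any.cartesianProductWith⁺ (insert zero) step (∈.∈-allFin (π ⟨$⟩ʳ zero)) (permutations-complete (remove zero π))
  where
  step : ∀ {j σ} → π ⟨$⟩ʳ zero ≡ j → remove zero π ≈ₚ σ → π ≈ₚ insert zero j σ
  step ≡.refl e zero    = ≡.refl
  step {σ = σ} ≡.refl e (suc i) =
    ≡.trans (punchIn-permute π zero i)
    (≡.trans (cong (punchIn _) (e i)) (≡.sym (insert-punchIn zero (π ⟨$⟩ʳ zero) σ i)))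

permutations-unique : ∀ n → AllPairs (λ π ρ → ¬ π ≈ₚ ρ) (permutations n)
permutations-unique zero    = [] ∷ []
permutations-unique (suc n) =
  Uniqueₛ.cartesianProductWith⁺ (≡.setoid _) (permutationSetoid n) (permutationSetoid (suc n))
    (insert zero) inj (Unique.allFin⁺ (suc n)) (permutations-unique n)
  where
  inj : ∀ {j j′ : Fin (suc n)} {σ σ′ : Permutation′ n} → insert zero j σ ≈ₚ insert zero j′ σ′ → j ≡ j′ × σ ≈ₚ σ′
  inj {j} {j′} {σ} {σ′} e with e zero
  ... | ≡.refl = ≡.refl , λ i → Fin.punchIn-injective j _ _
    (≡.trans (≡.sym (insert-punchIn zero j σ i)) (≡.trans (e (suc i)) (insert-punchIn zero j σ′ i)))

-- u acting on the first k positions, v on the last m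
_⊞_ : ∀ {k m} → Permutation′ k → Permutation′ m → Permutation′ (k ℕ.+ m)
u ⊞ v = ↔-trans Fin.+↔⊎ (↔-trans (u ⊎-↔ v) (↔-sym Fin.+↔⊎))

-- Partition k m consists of the ν ⊆ (m)^k, listed from the first row:
-- the first part a is at most m and bounds the remaining parts.
data Partition : ℕ → ℕ → Set where
  []  : ∀ {m} → Partition zero m
  _∷_ : ∀ {k m} (a : Fin (suc m)) → Partition k (toℕ a) → Partition (suc k) m

row : ∀ {k m} → Partition k m → Fin k → ℕ
row (a ∷ ν) zero    = toℕ a
row (a ∷ ν) (suc i) = row ν i

row-bounded : ∀ {k m} (ν : Partition k m) i → row ν i ℕ.≤ m
row-bounded (a ∷ ν) zero    = ℕ.≤-pred (Fin.toℕ<n a)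
row-bounded (a ∷ ν) (suc i) = ℕ.≤-trans (row-bounded ν i) (ℕ.≤-pred (Fin.toℕ<n a))

row-decreasing : ∀ {k m} (ν : Partition k m) {i j} → i Fin.≤ j → row ν j ℕ.≤ row ν i
row-decreasing (a ∷ ν) {zero}  {zero}  _           = ℕ.≤-refl
row-decreasing (a ∷ ν) {zero}  {suc j} _           = row-bounded ν j
row-decreasing (a ∷ ν) {suc i} {suc j} (ℕ.s≤s i≤j) = row-decreasing ν i≤j

partitions : ∀ k m → List (Partition k m)
partitions zero    m = [ [] ]
partitions (suc k) m = concatMap (λ a → map (a ∷_) (partitions k (toℕ a))) (allFin (suc m))

partitions-complete : ∀ {k m} (ν : Partition k m) → ν ∈ partitions k m
partitions-complete []      = here ≡.refl
partitions-complete {suc k} {m} (a ∷ ν) =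
  ∈.∈-concatMap⁺ (λ a → map (a ∷_) (partitions k (toℕ a)))
    (Any.map (λ { ≡.refl → ∈.∈-map⁺ (a ∷_) (partitions-complete ν) }) (∈.∈-allFin a))

partitions-unique : ∀ k m → Unique (partitions k m)
partitions-unique zero    m = [] ∷ []
partitions-unique (suc k) m = Unique.concat⁺
  (All.map⁺ (All.universal (λ a → Unique.map⁺ (λ { ≡.refl → ≡.refl }) (partitions-unique k (toℕ a))) _))
  (AllPairs.map⁺ (AllPairs.map (λ a≢b {ν} (ν∈a , ν∈b) → a≢b (same {ν = ν} ν∈a ν∈b)) (Unique.allFin⁺ (suc m))))
  where
  same : ∀ {a b : Fin (suc m)} {ν} → ν ∈ map (a ∷_) (partitions k (toℕ a)) → ν ∈ map (b ∷_) (partitions k (toℕ b)) → a ≡ b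
  same {a} {b} ν∈a ν∈b with ∈.∈-map⁻ (a ∷_) ν∈a | ∈.∈-map⁻ (b ∷_) ν∈b
  ... | _ , _ , ≡.refl | _ , _ , ≡.refl = ≡.refl

-- The number νᵢ + k + 1 - i, as an index: with i 0-based, k + 1 - i is
-- the 0-based index opposite i.
position : ∀ {k m} → Partition k m → Fin k → Fin (k ℕ.+ m)
position {k} {m} ν i = fromℕ< {row ν i ℕ.+ toℕ (opposite i)}
  (≡.subst (row ν i ℕ.+ toℕ (opposite i) ℕ.<_) (ℕ.+-comm m k)
    (ℕ.+-mono-≤-< (row-bounded ν i) (Fin.toℕ<n (opposite i))))

dropLastRow : ∀ {k m} → Partition (suc k) m → Partition k m
dropLastRow {zero}  ν       = []
dropLastRow {suc k} (a ∷ ν) = a ∷ dropLastRow ν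

-- w_ν is characterised by w-value and w-increasing below: its first
-- value is ν_k + 1, and the rest is the permutation of ν without row k.
w : ∀ {k m} → Partition k m → Permutation′ (k ℕ.+ m)
w {zero}      ν = idₚ
w {suc k} {m} ν = insert zero (fromℕ< {row ν (fromℕ k)} (ℕ.s≤s (ℕ.≤-trans (row-bounded ν (fromℕ k)) (ℕ.m≤n+m m k)))) (w (dropLastRow ν))

private
  row-dropLastRow : ∀ {k m} (ν : Partition (suc k) m) i → row (dropLastRow ν) i ≡ row ν (inject₁ i)
  row-dropLastRow {suc k} (a ∷ ν) zero    = ≡.refl
  row-dropLastRow {suc k} (a ∷ ν) (suc i) = row-dropLastRow ν i

  punchIn-≥ : ∀ {n} (j : Fin (suc n)) (i : Fin n) → toℕ j ℕ.≤ toℕ i → toℕ (punchIn j i) ≡ suc (toℕ i)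
  punchIn-≥ zero    i       _           = ≡.refl
  punchIn-≥ (suc j) (suc i) (ℕ.s≤s j≤i) = cong suc (punchIn-≥ j i j≤i)

  punchIn-mono-< : ∀ {n} (j : Fin (suc n)) {i i′ : Fin n} → i Fin.< i′ → punchIn j i Fin.< punchIn j i′
  punchIn-mono-< j {i} {i′} i<i′ = ℕ.≰⇒> λ le → ℕ.<⇒≱ i<i′ (Fin.punchIn-cancel-≤ j i′ i le)

  w-value′ : ∀ {k m} (ν : Partition k m) j → toℕ (w ν ⟨$⟩ʳ (j ↑ˡ m)) ≡ row ν (opposite j) ℕ.+ toℕ j
  w-value′ {suc k} ν zero = ≡.trans (Fin.toℕ-fromℕ< _) (≡.sym (ℕ.+-identityʳ _))
  w-value′ {suc k} {m} ν (suc j) = begin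
    toℕ (insert zero a π ⟨$⟩ʳ suc (j ↑ˡ m))            ≡⟨ cong toℕ (insert-punchIn zero a π (j ↑ˡ m)) ⟩
    toℕ (punchIn a (π ⟨$⟩ʳ (j ↑ˡ m)))                  ≡⟨ punchIn-≥ a _ a≤ ⟩
    suc (toℕ (π ⟨$⟩ʳ (j ↑ˡ m)))                        ≡⟨ cong suc ih ⟩
    suc (row ν (inject₁ (opposite j)) ℕ.+ toℕ j)       ≡⟨ ℕ.+-suc _ _ ⟨
    row ν (inject₁ (opposite j)) ℕ.+ suc (toℕ j) ∎
    where
    open ≡.≡-Reasoning
    π = w (dropLastRow ν)
    a = w ν ⟨$⟩ʳ zero
    ih : toℕ (π ⟨$⟩ʳ (j ↑ˡ m)) ≡ row ν (inject₁ (opposite j)) ℕ.+ toℕ j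
    ih = ≡.trans (w-value′ (dropLastRow ν) j) (cong (ℕ._+ toℕ j) (row-dropLastRow ν (opposite j)))
    a≤ : toℕ a ℕ.≤ toℕ (π ⟨$⟩ʳ (j ↑ˡ m))
    a≤ = ≡.subst₂ ℕ._≤_ (≡.sym (Fin.toℕ-fromℕ< _)) (≡.sym ih)
      (ℕ.≤-trans (row-decreasing ν (Fin.≤fromℕ (inject₁ (opposite j)))) (ℕ.m≤m+n _ _))

w-value : ∀ {k m} (ν : Partition k m) i → w ν ⟨$⟩ʳ (opposite i ↑ˡ m) ≡ position ν i
w-value ν i = Fin.toℕ-injective (≡.trans (w-value′ ν (opposite i))
  (≡.trans (cong (λ j → row ν j ℕ.+ toℕ (opposite i)) (Fin.opposite-involutive i)) (≡.sym (Fin.toℕ-fromℕ< _))))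

w-increasing : ∀ {k m} (ν : Partition k m) {j j′ : Fin m} → j Fin.< j′ → w ν ⟨$⟩ʳ (k ↑ʳ j) Fin.< w ν ⟨$⟩ʳ (k ↑ʳ j′)
w-increasing {zero}  ν j<j′ = j<j′
w-increasing {suc k} ν {j} {j′} j<j′ = ≡.subst₂ Fin._<_
  (≡.sym (insert-punchIn zero a π (k ↑ʳ j))) (≡.sym (insert-punchIn zero a π (k ↑ʳ j′)))
  (punchIn-mono-< a (w-increasing (dropLastRow ν) j<j′))
  where
  π = w (dropLastRow ν)
  a = w ν ⟨$⟩ʳ zero

private
  -- Paths whose intermediate vertices lie in a given list.
  module Reachability {A : Set} (_≟_ : DecidableEquality A) {_⟶_ : Rel A 0ℓ} (_⟶?_ : Decidable _⟶_) where

    Via : List A → Rel A 0ℓ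
    Via []       a b = a ≡ b ⊎ a ⟶ b
    Via (v ∷ vs) a b = Via vs a b ⊎ (Via vs a v × Via vs v b)

    via? : ∀ vs → Decidable (Via vs)
    via? []       a b = (a ≟ b) ⊎-dec (a ⟶? b)
    via? (v ∷ vs) a b = via? vs a b ⊎-dec (via? vs a v ×-dec via? vs v b)

    base : ∀ vs {a b} → a ≡ b ⊎ a ⟶ b → Via vs a b
    base []       h = h
    base (v ∷ vs) h = inj₁ (base vs h)

    via⇒star : ∀ vs {a b} → Via vs a b → Star _⟶_ a b
    via⇒star []       (inj₁ ≡.refl)  = ε
    via⇒star []       (inj₂ e)       = e ◅ ε
    via⇒star (v ∷ vs) (inj₁ h)       = via⇒star vs h
    via⇒star (v ∷ vs) (inj₂ (h , k)) = via⇒star vs h ◅◅ via⇒star vs k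

    to-head : ∀ {v vs a} → Via (v ∷ vs) a v → Via vs a v
    to-head (inj₁ h)       = h
    to-head (inj₂ (h , _)) = h

    from-head : ∀ {v vs b} → Via (v ∷ vs) v b → Via vs v b
    from-head (inj₁ h)       = h
    from-head (inj₂ (_ , h)) = h

    join : ∀ {vs u a b} → u ∈ vs → Via vs a u → Via vs u b → Via vs a b
    join (here ≡.refl) h                k                = inj₂ (to-head h , from-head k)
    join (there u∈)    (inj₁ h)         (inj₁ k)         = inj₁ (join u∈ h k)
    join (there u∈)    (inj₁ h)         (inj₂ (k , k′))  = inj₂ (join u∈ h k , k′)
    join (there u∈)    (inj₂ (h , h′))  (inj₁ k)         = inj₂ (h , join u∈ h′ k)
    join (there u∈)    (inj₂ (h , _))   (inj₂ (_ , k′))  = inj₂ (h , k′)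

    star⇒via : ∀ {vs} → (∀ u → u ∈ vs) → ∀ {a b} → Star _⟶_ a b → Via vs a b
    star⇒via {vs} all ε                 = base vs (inj₁ ≡.refl)
    star⇒via {vs} all (_◅_ {j = u} e h) = join (all u) (base vs (inj₂ e)) (star⇒via all h)

    star? : ∀ {vs} → (∀ u → u ∈ vs) → Decidable (Star _⟶_)
    star? {vs} all a b = map′ (via⇒star vs) (star⇒via all) (via? vs a b)

-- Row and column; rows are numbered from the top, columns from the left.
Box : ℕ → ℕ → Set
Box k m = Fin k × Fin m

Adjacent : ∀ {k m} → Rel (Box k m) 0ℓ
Adjacent (r , c) (r′ , c′) = ∣ toℕ r - toℕ r′ ∣ ℕ.+ ∣ toℕ c - toℕ c′ ∣ ≡ 1

private
  allBoxes? : ∀ {k m} {P : Box k m → Set} → (∀ b → Dec (P b)) → Dec (∀ b → P b)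
  allBoxes? P? = map′ (λ h (r , c) → h r c) (λ h r c → h (r , c)) (Fin.all? λ r → Fin.all? λ c → P? (r , c))

  anyBox? : ∀ {k m} {P : Box k m → Set} → (∀ b → Dec (P b)) → Dec (∃ P)
  anyBox? P? = map′ (λ (r , c , h) → (r , c) , h) (λ ((r , c) , h) → r , c , h) (Fin.any? λ r → Fin.any? λ c → P? (r , c))

module Skew {k m : ℕ} (μ ν : Partition k m) where

  Contained : Set
  Contained = ∀ r → row ν r ℕ.≤ row μ r

  -- The box lies in μ/ν; row r occupies the 0-based columns ν_r, …, μ_r - 1.
  Inside : Box k m → Set
  Inside (r , c) = row ν r ℕ.≤ toℕ c × toℕ c ℕ.< row μ r

  Step : Rel (Box k m) 0ℓ
  Step b b′ = Inside b × Inside b′ × Adjacent b b′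

  Connected : Set
  Connected = ∀ b b′ → Inside b → Inside b′ → Star Step b b′

  Square : Box k m → Box k m → Set
  Square (r , c) (r′ , c′) =
    toℕ r′ ≡ suc (toℕ r) × toℕ c′ ≡ suc (toℕ c) ×
    Inside (r , c) × Inside (r , c′) × Inside (r′ , c) × Inside (r′ , c′)

  record IsRibbon : Set where
    field
      contained : Contained
      nonempty  : ∃ Inside
      connected : Connected
      no-square : ∀ b b′ → ¬ Square b b′

  IsHead : Box k m → Set
  IsHead (r , c) = Inside (r , c) × (∀ b → Inside b → r Fin.≤ proj₁ b × proj₂ b Fin.≤ c)

  RibbonWithHeadInRow : Fin k → Set
  RibbonWithHeadInRow i = IsRibbon × ∃ λ c → IsHead (i , c)

  inside? : ∀ b → Dec (Inside b)
  inside? (r , c) = (row ν r ℕ.≤? toℕ c) ×-dec (toℕ c ℕ.<? row μ r)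

  private
    connected? : Dec Connected
    connected? = allBoxes? λ b → allBoxes? λ b′ → inside? b →-dec inside? b′ →-dec star? complete b b′
      where
      step? : Decidable Step
      step? b b′ = inside? b ×-dec inside? b′ ×-dec (_ ℕ.≟ 1)
      complete : ∀ b → b ∈ cartesianProduct (allFin k) (allFin m)
      complete (r , c) = ∈.∈-cartesianProduct⁺ (∈.∈-allFin r) (∈.∈-allFin c)
      open Reachability (Product.≡-dec Fin._≟_ Fin._≟_) step?

    square? : ∀ b b′ → Dec (Square b b′)
    square? (r , c) (r′ , c′) = (_ ℕ.≟ _) ×-dec (_ ℕ.≟ _) ×-dec
      inside? (r , c) ×-dec inside? (r , c′) ×-dec inside? (r′ , c) ×-dec inside? (r′ , c′)

    isRibbon? : Dec IsRibbon
    isRibbon? = map′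
      (λ (h₁ , h₂ , h₃ , h₄) → record { contained = h₁ ; nonempty = h₂ ; connected = h₃ ; no-square = h₄ })
      (λ R → let open IsRibbon R in contained , nonempty , connected , no-square)
      (Fin.all? (λ r → row ν r ℕ.≤? row μ r) ×-dec anyBox? inside? ×-dec connected?
        ×-dec allBoxes? (λ b → allBoxes? (λ b′ → ¬? (square? b b′))))

  ribbonWithHeadInRow? : ∀ i → Dec (RibbonWithHeadInRow i)
  ribbonWithHeadInRow? i = isRibbon? ×-dec Fin.any? λ c →
    inside? (i , c) ×-dec allBoxes? λ b → inside? b →-dec (i Fin.≤? proj₁ b) ×-dec (proj₂ b Fin.≤? c)

  ht wd : ℕ
  ht = length (filter (λ r → Fin.any? λ c → inside? (r , c)) (allFin k))
  wd = length (filter (λ c → Fin.any? λ r → inside? (r , c)) (allFin m))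

-- From here on m stands for n - k.

module Operators (k m : ℕ) where

  open RingOps (CommutativeRing.ring (polynomialRing 𝒜ħ (Fin (k ℕ.+ m))))
  open Presented 𝒜ħ (Fin (k ℕ.+ m)) using (con; var)
  open Scalars using (p; q; ħ)

  𝒜ħ[x] : Set
  𝒜ħ[x] = Carrier

  -- Formal left 𝒜ħ[x₁, …, xₙ]-linear combinations of the T̄_ν
  Combination : Set
  Combination = List (𝒜ħ[x] × Partition k m)

  basis : Partition k m → Combination
  basis ν = [ 1# , ν ]

  _·_ : 𝒜ħ[x] → Combination → Combination
  g · c = map (λ (f , ν) → g * f , ν) c

  -- The factor for a ribbon μ/ν with head in row i; position μ i is 𝚑(μ/ν).
  coefficient : Fin k → Partition k m → Partition k m → 𝒜ħ[x]
  coefficient i μ ν =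
    (con ħ - (con p - con q) * var (position μ i)) * con p ^ (ht ∸ 1) * con q ^ (wd ∸ 1)
    where open Skew μ ν

  D-basis : Fin k → Partition k m → Combination
  D-basis i μ =
    (var (position μ i) , μ) ∷
    map (λ ν → coefficient i μ ν , ν)
        (filter (λ ν → Skew.ribbonWithHeadInRow? μ ν i) (partitions k m))

  D : Fin k → Combination → Combination
  D i = concatMap (λ (g , μ) → g · D-basis i μ)

module Grassmannian (k m : ℕ) where

  open Operators k m public

  module A = Scalars
  module 𝒜ħ[1/] = Localization 𝒜ħ (A.[[ k ]]! A.* A.[[ m ]]!)

  ι : A.Carrier → 𝒜ħ[1/].Term
  ι = 𝒜ħ[1/].con

  module H = Hecke 𝒜ħ[1/].R[1/s] (ι A.p) (ι A.q) (ι A.ħ) (k ℕ.+ m)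
  module P = Presented 𝒜ħ (Fin (k ℕ.+ m))

  open RingOps H.Ĥ public
  open H public using (x)

  T̄ : Permutation′ (k ℕ.+ m) → Carrier
  T̄ π = ∏ (map H.T̄ (ReducedWord.letters (reducedWord π)))

  d : ℕ
  d = k C 2 ℕ.+ m C 2

  Σⁿₖ : Carrier
  Σⁿₖ = H.con 𝒜ħ[1/].1/s * ∑ (cartesianProductWith summand (permutations k) (permutations m))
    where
    summand : Permutation′ k → Permutation′ m → Carrier
    summand u v = H.con (ι (A.q A.^ (d ∸ ℓ (u ⊞ v)))) * T̄ (u ⊞ v)

  T̄[_] : Partition k m → Carrier
  T̄[ ν ] = T̄ (w ν) * Σⁿₖ

  ⟦_⟧ : 𝒜ħ[x] → Carrier
  ⟦ P.con a ⟧ = H.con (ι a)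
  ⟦ P.var j ⟧ = x j
  ⟦ f P.⊕ g ⟧ = ⟦ f ⟧ + ⟦ g ⟧
  ⟦ f P.⊗ g ⟧ = ⟦ f ⟧ * ⟦ g ⟧
  ⟦ P.⊝ f ⟧   = - ⟦ f ⟧

  value : Combination → Carrier
  value c = ∑ (map (λ (g , ν) → ⟦ g ⟧ * T̄[ ν ]) c)

  private
    open import Algebra.Properties.Ring H.Ĥ using (-‿distribˡ-*; -‿distribʳ-*)

    ⟦⟧-comm-x : ∀ j f → x j * ⟦ f ⟧ ≈ ⟦ f ⟧ * x j
    ⟦⟧-comm-x j (P.con a) = sym (H.con-central (ι a) (x j))
    ⟦⟧-comm-x j (P.var i) = H.relation (H.x-comm j i)
    ⟦⟧-comm-x j (f P.⊕ g) = trans (distribˡ _ _ _) (trans (+-cong (⟦⟧-comm-x j f) (⟦⟧-comm-x j g)) (sym (distribʳ _ _ _)))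
    ⟦⟧-comm-x j (f P.⊗ g) = trans (sym (*-assoc _ _ _)) (trans (*-congʳ (⟦⟧-comm-x j f))
      (trans (*-assoc _ _ _) (trans (*-congˡ (⟦⟧-comm-x j g)) (sym (*-assoc _ _ _)))))
    ⟦⟧-comm-x j (P.⊝ f)   = trans (sym (-‿distribʳ-* _ _)) (trans (-‿cong (⟦⟧-comm-x j f)) (-‿distribˡ-* _ _))

    ⟦⟧-comm : ∀ f g → ⟦ f ⟧ * ⟦ g ⟧ ≈ ⟦ g ⟧ * ⟦ f ⟧
    ⟦⟧-comm (P.con a)  g = H.con-central (ι a) ⟦ g ⟧
    ⟦⟧-comm (P.var j)  g = ⟦⟧-comm-x j g
    ⟦⟧-comm (f P.⊕ f′) g = trans (distribʳ _ _ _) (trans (+-cong (⟦⟧-comm f g) (⟦⟧-comm f′ g)) (sym (distribˡ _ _ _)))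
    ⟦⟧-comm (f P.⊗ f′) g = trans (*-assoc _ _ _) (trans (*-congˡ (⟦⟧-comm f′ g))
      (trans (sym (*-assoc _ _ _)) (trans (*-congʳ (⟦⟧-comm f g)) (*-assoc _ _ _))))
    ⟦⟧-comm (P.⊝ f)    g = trans (sym (-‿distribˡ-* _ _)) (trans (-‿cong (⟦⟧-comm f g)) (-‿distribʳ-* _ _))

  ⟦⟧-cong : ∀ {f g} → CommutativeRing._≈_ (polynomialRing 𝒜ħ (Fin (k ℕ.+ m))) f g → ⟦ f ⟧ ≈ ⟦ g ⟧
  ⟦⟧-cong (P.relation (P.commutes f g)) = ⟦⟧-comm f g
  ⟦⟧-cong P.refl            = H.refl
  ⟦⟧-cong (P.sym e)         = H.sym (⟦⟧-cong e)
  ⟦⟧-cong (P.trans e e′)    = H.trans (⟦⟧-cong e) (⟦⟧-cong e′)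
  ⟦⟧-cong (P.⊕-cong e e′)   = H.⊕-cong (⟦⟧-cong e) (⟦⟧-cong e′)
  ⟦⟧-cong (P.⊗-cong e e′)   = H.⊗-cong (⟦⟧-cong e) (⟦⟧-cong e′)
  ⟦⟧-cong (P.⊝-cong e)      = H.⊝-cong (⟦⟧-cong e)
  ⟦⟧-cong (P.⊕-assoc _ _ _) = H.⊕-assoc _ _ _
  ⟦⟧-cong (P.⊕-comm _ _)    = H.⊕-comm _ _
  ⟦⟧-cong (P.⊕-identity _)  = H.⊕-identity _
  ⟦⟧-cong (P.⊕-inverse _)   = H.⊕-inverse _
  ⟦⟧-cong (P.⊗-assoc _ _ _) = H.⊗-assoc _ _ _
  ⟦⟧-cong (P.⊗-identity _)  = H.⊗-identity _
  ⟦⟧-cong (P.distribˡ _ _ _) = H.distribˡ _ _ _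
  ⟦⟧-cong (P.distribʳ _ _ _) = H.distribʳ _ _ _
  ⟦⟧-cong (P.con-cong e)    = H.con-cong (𝒜ħ[1/].con-cong e)
  ⟦⟧-cong (P.con-+ a b)     = H.trans (H.con-cong (𝒜ħ[1/].con-+ a b)) (H.con-+ (ι a) (ι b))
  ⟦⟧-cong (P.con-* a b)     = H.trans (H.con-cong (𝒜ħ[1/].con-* a b)) (H.con-* (ι a) (ι b))
  ⟦⟧-cong (P.con-central a _) = H.con-central (ι a) _

{-# OPTIONS --safe #-}
module Submission where

-- Number generators and variables from 0, so that S_a = T̄_{a+1} involves x_a and
-- x_{a+1}, and put κ_j = ħ - (p - q) x_j.  Then S_a x_a = x_{a+1} S_a + κ_{a+1}
-- and S_a κ_a = κ_{a+1} (S_a - (p - q)).  Factor T̄_{w_μ} row by row as a product of descending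
-- runs S_{j+b-1} ⋯ S_j (j = k - i for the 1-based row i, b = μ_i).  The variable x_j commutes with
-- the runs of the rows above, and pushing it through its own run gives x_{j+b} times
-- the run, plus κ_{j+b} times Σ_{t<b} q^{b-1-t} S_{j+t-1} ⋯ S_j; this uses only that
-- the element z on the right satisfies S_a z = p z for a < j and for a ≥ k.  The run
-- of the next row, of length b′, turns the terms with t < b′ into p times the same
-- kind of sum one row lower, so iterating enumerates the ribbons with head in row i
-- by their tails, with weight p^{ht-1} q^{wd-1}.  Since the indices increase, all of
-- this applies to z = Σ times the remaining variables, and one concludes by induction on r.

open import Level using (0ℓ)
open import Algebra.Bundles using (CommutativeMonoid; CommutativeRing; Ring)
open import Data.Empty using (⊥)
open import Data.Nat.Base as ℕ using (ℕ; zero; suc; _≤_; _<_; z≤n; s≤s; _∸_)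
import Data.Nat.Properties as ℕ
open import Data.Nat.Combinatorics using (_C_; nC1≡n; nCk+nC[k+1]≡[n+1]C[k+1])
open import Data.Nat.ListAction using (sum)
open import Data.Nat.ListAction.Properties using (sum-++)
open import Data.Fin.Base as Fin using (Fin; zero; suc; toℕ; fromℕ<; fromℕ; punchIn; _↑ˡ_; _↑ʳ_; splitAt; opposite)
import Data.Fin.Properties as Fin
open import Data.Fin.Permutation using (Permutation′; _⟨$⟩ʳ_; insert; remove; punchIn-permute; remove-insert) renaming (id to idₚ; _≈_ to _≈ₚ_)
open import Data.List.Base using (List; []; _∷_; _++_; map; filter; length; allFin; tabulate; cartesianProductWith; foldl)
import Data.List.Properties as List
open import Data.List.Membership.Propositional using (_∈_)
import Data.List.Membership.Propositional.Properties as ∈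
open import Data.List.Membership.Propositional.Properties.WithK using (unique∧set⇒bag)
open import Data.List.Relation.Binary.BagAndSetEquality using (∼bag⇒↭)
open import Data.List.Relation.Binary.Permutation.Propositional as ↭ using (_↭_)
open import Data.List.Relation.Unary.All as All using (All; []; _∷_)
open import Data.List.Relation.Unary.AllPairs using (AllPairs; []; _∷_)
open import Data.List.Relation.Unary.Any using (here; there)
open import Data.List.Relation.Unary.Linked using (Linked)
open import Data.List.Relation.Unary.Linked.Properties using (Linked⇒AllPairs)
open import Data.List.Relation.Unary.Unique.Propositional using (Unique)
import Data.List.Relation.Unary.Unique.Propositional.Properties as Unique
open import Data.Product.Base using (∃; ∃₂; _×_; _,_; proj₁; proj₂)
open import Data.Sum.Base using (_⊎_; inj₁; inj₂)
open import Data.Vec.Base using (Vec; []; _∷_; lookup)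
open import Data.Vec.Properties using (∷-injectiveʳ)
open import Function.Base using (_∘_; id)
open import Function.Bundles using (_⇔_; mk⇔; Equivalence)
open import Relation.Binary.Construct.Closure.ReflexiveTransitive as Star using (Star; ε; _◅_; _◅◅_)
open import Relation.Binary.PropositionalEquality as ≡ using (_≡_; _≢_; cong; cong₂)
open import Relation.Nullary using (Dec; yes; no)
open import Relation.Nullary.Negation using (contradiction)
open import Relation.Unary using (Decidable)
open import Defs

-- Two obstacles shape the proof. The ribbons of the statement are given by connectedness, squares
-- and an extreme box, whereas the algebra produces a recursion along the rim. `Chain`, a set of
-- inequalities between consecutive rows, mediates between the two, and the sums are then matched as
-- duplicate-free lists with the same members. On the algebraic side the factor p comes from (S_a -
-- p)(S_a + q) = 0: with the weights q^(d-ℓ(v)), Σ has a left factor S_a + q for every generator of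
-- S_k × S_{n-k}, hence S_a Σ = p Σ. A variable x_b in front of Σ may destroy this equation for a =
-- b - 1 and a = b. This is why each lemma that moves x_j states for which a it needs S_a z = p z,
-- and why the smallest index is moved first: the equations for a < j then survive.

private variable
  k m : ℕ
  a b h w′ : ℕ

-- Partitions as vectors of row lengths.

-- In `Partition` the type of the tail depends on the first part, so removing a box changes types.
-- With plain vectors of row lengths the shape condition becomes a separate proof.
data Fits : ℕ → Vec ℕ k → Set where
  []  : Fits m []
  _∷_ : {v : Vec ℕ k} → a ≤ m → Fits a v → Fits m (a ∷ v)

-- The value 0 lets the bottom row behave as if an empty row followed it, so that the test
-- `top l ≤ b` always succeeds there.
top : Vec ℕ k → ℕ
top []      = 0
top (a ∷ _) = a

Fits-rebound : {v : Vec ℕ k} → top v ≤ b → Fits m v → Fits b v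
Fits-rebound le []        = []
Fits-rebound le (_ ∷ fit) = le ∷ fit

Fits-lookup : {v : Vec ℕ k} → Fits m v → ∀ i → lookup v i ≤ m
Fits-lookup (a≤m ∷ fit) zero    = a≤m
Fits-lookup (a≤m ∷ fit) (suc i) = ℕ.≤-trans (Fits-lookup fit i) a≤m

rows : Partition k m → Vec ℕ k
rows []      = []
rows (a ∷ ν) = toℕ a ∷ rows ν

lookup-rows : (ν : Partition k m) → ∀ i → lookup (rows ν) i ≡ row ν i
lookup-rows (a ∷ ν) zero    = ≡.refl
lookup-rows (a ∷ ν) (suc i) = lookup-rows ν i

rows-fit : (ν : Partition k m) → Fits m (rows ν)
rows-fit []      = []
rows-fit (a ∷ ν) = ℕ.≤-pred (Fin.toℕ<n a) ∷ rows-fit ν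

rows-injective : {μ ν : Partition k m} → rows μ ≡ rows ν → μ ≡ ν
rows-injective {μ = []}    {[]}    eq = ≡.refl
rows-injective {μ = a ∷ μ} {b ∷ ν} eq with Fin.toℕ-injective (cong top eq)
... | ≡.refl = cong (a ∷_) (rows-injective (∷-injectiveʳ eq))

fromRows : {v : Vec ℕ k} → Fits m v → ∃ λ (ν : Partition k m) → rows ν ≡ v
fromRows [] = [] , ≡.refl
fromRows {v = _ ∷ v} (a≤m ∷ fit) =
  let eq     = Fin.toℕ-fromℕ< (s≤s a≤m)
      ν , eq′ = fromRows (≡.subst (λ z → Fits z v) (≡.sym eq) fit)
  in fromℕ< (s≤s a≤m) ∷ ν , cong₂ _∷_ eq eq′

-- Ribbons as paths along the rim.

-- Ribbon i v u h w says that v/u is a ribbon with head in row i, height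
-- h + 1 and width w + 1; it is built up box by box, ending at the head.
data Ribbon : Fin k → Vec ℕ k → Vec ℕ k → ℕ → ℕ → Set where
  emit  : {l : Vec ℕ k} → top l ≤ b → Ribbon zero (suc b ∷ l) (b ∷ l) 0 0
  left  : {l : Vec ℕ k} {u : Vec ℕ (suc k)} → top l ≤ b → Ribbon zero (b ∷ l) u h w′ → Ribbon zero (suc b ∷ l) u h (suc w′)
  down  : {l : Vec ℕ k} {u : Vec ℕ (suc k)} → Ribbon zero (suc b ∷ l) u h w′ → Ribbon zero (suc b ∷ suc b ∷ l) (b ∷ u) (suc h) w′
  above : {l u : Vec ℕ k} {i : Fin k} → Ribbon i l u h w′ → Ribbon (suc i) (a ∷ l) (a ∷ u) h w′

Weighted : ℕ → Set
Weighted k = ℕ × ℕ × Vec ℕ k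

widen : Weighted k → Weighted k
widen (h , w , u) = h , suc w , u

lower : ℕ → Weighted k → Weighted (suc k)
lower b (h , w , u) = suc h , w , b ∷ u

prepend : ℕ → Weighted k → Weighted (suc k)
prepend a (h , w , u) = h , w , a ∷ u

-- The rim is followed from the head. If the next row is shorter, there is no box below the head,
-- and the ribbon either ends here or continues to the left. If the next row is equally long, the
-- box below has to go too, for the result to be a partition, and taking a second box from the upper
-- row would create a square; so the path is forced down.
headRibbons : ℕ → Vec ℕ k → List (Weighted (suc k))
headRibbons zero    l = []
headRibbons (suc b) l with top l ℕ.≤? b
headRibbons (suc b) l       | yes _ = (0 , 0 , b ∷ l) ∷ map widen (headRibbons b l)
headRibbons (suc b) []      | no _  = []
headRibbons (suc b) (_ ∷ l) | no _  = map (lower b) (headRibbons (suc b) l)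

ribbons : Fin k → Vec ℕ k → List (Weighted k)
ribbons zero    (b ∷ l) = headRibbons b l
ribbons (suc i) (a ∷ l) = map (prepend a) (ribbons i l)

headRibbons-unique : ∀ b (l : Vec ℕ k) → Unique (headRibbons b l)
headRibbons-unique zero    l = []
headRibbons-unique (suc b) l with top l ℕ.≤? b
headRibbons-unique (suc b) l       | yes _ =
  All.tabulate (λ e∈ → λ { ≡.refl → case-widen (∈.∈-map⁻ widen e∈) })
  ∷ Unique.map⁺ (λ { ≡.refl → ≡.refl }) (headRibbons-unique b l)
  where
  case-widen : ∀ {h : ℕ} {u} → (∃ λ e → e ∈ headRibbons b l × (h , 0 , u) ≡ widen e) → ⊥
  case-widen (_ , _ , ())
headRibbons-unique (suc b) []      | no _ = []
headRibbons-unique (suc b) (_ ∷ l) | no _ = Unique.map⁺ (λ { ≡.refl → ≡.refl }) (headRibbons-unique (suc b) l)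

ribbons-unique : (i : Fin k) (v : Vec ℕ k) → Unique (ribbons i v)
ribbons-unique zero    (b ∷ l) = headRibbons-unique b l
ribbons-unique (suc i) (a ∷ l) = Unique.map⁺ (λ { ≡.refl → ≡.refl }) (ribbons-unique i l)

headRibbons-sound : ∀ b (l : Vec ℕ k) → Fits b l → ∀ {h w u} → (h , w , u) ∈ headRibbons b l → Ribbon zero (b ∷ l) u h w
headRibbons-sound (suc b) l fit e∈ with top l ℕ.≤? b
headRibbons-sound (suc b) l fit (here ≡.refl) | yes le = emit le
headRibbons-sound (suc b) l fit (there e∈)    | yes le with ∈.∈-map⁻ widen e∈
... | _ , e′∈ , ≡.refl = left le (headRibbons-sound b l (Fits-rebound le fit) e′∈)
headRibbons-sound (suc b) (c ∷ l) (c≤ ∷ fit) e∈ | no c≰b with ℕ.≤-antisym c≤ (ℕ.≰⇒> c≰b) | ∈.∈-map⁻ (lower b) e∈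
... | ≡.refl | _ , e′∈ , ≡.refl = down (headRibbons-sound (suc b) l fit e′∈)

ribbons-sound : (i : Fin k) (v : Vec ℕ k) → Fits m v → ∀ {h w u} → (h , w , u) ∈ ribbons i v → Ribbon i v u h w
ribbons-sound zero    (b ∷ l) (_ ∷ fit) e∈ = headRibbons-sound b l fit e∈
ribbons-sound (suc i) (a ∷ l) (_ ∷ fit) e∈ with ∈.∈-map⁻ (prepend a) e∈
... | _ , e′∈ , ≡.refl = above (ribbons-sound i l fit e′∈)

ribbons-complete : {i : Fin k} {v u : Vec ℕ k} → Ribbon i v u h w′ → (h , w′ , u) ∈ ribbons i v
ribbons-complete {v = suc b ∷ l} (emit le) with top l ℕ.≤? b
... | yes _  = here ≡.refl
... | no ¬le = contradiction le ¬le
ribbons-complete {v = suc b ∷ l} (left le ρ) with top l ℕ.≤? b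
... | yes _  = there (∈.∈-map⁺ widen (ribbons-complete ρ))
... | no ¬le = contradiction le ¬le
ribbons-complete {v = suc b ∷ _} (down ρ) with suc b ℕ.≤? b
... | yes le = contradiction le ℕ.1+n≰n
... | no _   = ∈.∈-map⁺ (lower b) (ribbons-complete ρ)
ribbons-complete (above ρ) = ∈.∈-map⁺ (prepend _) (ribbons-complete ρ)

-- Strictness carries the induction: in `down` the upper row shrinks by one box, so the equally long
-- row below must have lost a box as well.
headRibbon-fits : {l : Vec ℕ k} {u : Vec ℕ (suc k)} → Fits b l → Ribbon zero (b ∷ l) u h w′ → top u < b × Fits (top u) u
headRibbon-fits fit (emit le) = ℕ.≤-refl , ℕ.≤-refl ∷ Fits-rebound le fit
headRibbon-fits fit (left le ρ) = let lt , fit′ = headRibbon-fits (Fits-rebound le fit) ρ in ℕ.m≤n⇒m≤1+n lt , fit′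
headRibbon-fits (_ ∷ fit) (down ρ) = let lt , fit′ = headRibbon-fits fit ρ in ℕ.≤-refl , ℕ.≤-refl ∷ Fits-rebound (ℕ.≤-pred lt) fit′

Ribbon-fits : {i : Fin k} {v u : Vec ℕ k} → Fits m v → Ribbon i v u h w′ → Fits m u
Ribbon-fits {i = zero} {v = b ∷ _} (b≤m ∷ fit) ρ = let lt , fit′ = headRibbon-fits fit ρ in Fits-rebound (ℕ.<⇒≤ (ℕ.<-≤-trans lt b≤m)) fit′
Ribbon-fits (a≤m ∷ fit) (above ρ) = a≤m ∷ Ribbon-fits fit ρ

Ribbon-rows : {i : Fin k} {v u : Vec ℕ k} → Ribbon i v u h w′ →
              ∀ s → lookup u s < lookup v s ⇔ (toℕ i ≤ toℕ s × toℕ s < toℕ i ℕ.+ suc h)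
Ribbon-rows (emit _) zero    = mk⇔ (λ _ → z≤n , s≤s z≤n) (λ _ → ℕ.≤-refl)
Ribbon-rows (emit _) (suc s) = mk⇔ (λ lt → contradiction lt (ℕ.<-irrefl ≡.refl)) λ { (_ , s≤s ()) }
Ribbon-rows (left _ ρ) zero = mk⇔ (λ _ → z≤n , s≤s z≤n)
  (λ _ → ℕ.m≤n⇒m≤1+n (Equivalence.from (Ribbon-rows ρ zero) (z≤n , s≤s z≤n)))
Ribbon-rows (left _ ρ) (suc s) = Ribbon-rows ρ (suc s)
Ribbon-rows (down ρ) zero    = mk⇔ (λ _ → z≤n , s≤s z≤n) (λ _ → ℕ.≤-refl)
Ribbon-rows (down ρ) (suc s) = mk⇔
  (λ lt → z≤n , s≤s (proj₂ (Equivalence.to (Ribbon-rows ρ s) lt)))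
  (λ { (_ , s≤s lt) → Equivalence.from (Ribbon-rows ρ s) (z≤n , lt) })
Ribbon-rows (above ρ) zero    = mk⇔ (λ lt → contradiction lt (ℕ.<-irrefl ≡.refl)) λ { (() , _) }
Ribbon-rows (above ρ) (suc s) = mk⇔
  (λ lt → let le , lt′ = Equivalence.to (Ribbon-rows ρ s) lt in s≤s le , s≤s lt′)
  (λ { (s≤s le , s≤s lt) → Equivalence.from (Ribbon-rows ρ s) (le , lt) })

Ribbon-height : {i : Fin k} {v u : Vec ℕ k} → Ribbon i v u h w′ → toℕ i ℕ.+ suc h ≤ k
Ribbon-height (emit _)   = s≤s z≤n
Ribbon-height (left _ ρ) = Ribbon-height ρ
Ribbon-height (down ρ)   = s≤s (Ribbon-height ρ)
Ribbon-height (above ρ)  = s≤s (Ribbon-height ρ)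

-- Consecutive rows of a ribbon share a column, so no column between tail and head is skipped; `e`
-- is the column of the tail. In `left` the only new column is `b`, that of the head. In `down` the
-- new head lies above a box of the same column, so the interval is unchanged.
Ribbon-columns : {i : Fin k} {v u : Vec ℕ k} → Ribbon i v u h w′ →
  ∃ λ e → e ℕ.+ suc w′ ≡ lookup v i ×
  (∀ c → (∃ λ s → lookup u s ≤ c × c < lookup v s) ⇔ (e ≤ c × c < lookup v i))
Ribbon-columns (emit {b = b} _) = b , ℕ.+-comm b 1 , λ c → mk⇔
  (λ { (zero , h) → h ; (suc s , le , lt) → contradiction (ℕ.≤-<-trans le lt) (ℕ.<-irrefl ≡.refl) })
  (λ h → zero , h)
Ribbon-columns {u = t ∷ _} (left {b = b} {w′ = w} _ ρ) with Ribbon-columns ρ | Equivalence.from (Ribbon-rows ρ zero) (z≤n , s≤s z≤n)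
... | e , eq , cols | t<b = e , ≡.trans (ℕ.+-suc e (suc w)) (cong suc eq) , λ c → mk⇔
  (λ { (zero , t≤c , s≤s c≤b) → to-zero t≤c c≤b
     ; (suc s , le , lt) → let le′ , lt′ = Equivalence.to (cols c) (suc s , le , lt) in le′ , ℕ.m≤n⇒m≤1+n lt′ })
  (λ { (e≤c , s≤s c≤b) → from e≤c c≤b })
  where
  to-zero : ∀ {c} → t ≤ c → c ≤ b → e ≤ c × c < suc b
  to-zero t≤c c≤b = ℕ.≤-trans (proj₁ (Equivalence.to (cols t) (zero , ℕ.≤-refl , t<b))) t≤c , s≤s c≤b
  from : ∀ {c} → e ≤ c → c ≤ b → ∃ λ s → _ × _
  from {c} e≤c c≤b with ℕ.m≤n⇒m<n∨m≡n c≤b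
  ... | inj₂ ≡.refl = zero , ℕ.<⇒≤ t<b , ℕ.≤-refl
  ... | inj₁ c<b with Equivalence.from (cols c) (e≤c , c<b)
  ...   | zero  , le , lt = zero , le , ℕ.m≤n⇒m≤1+n lt
  ...   | suc s , le , lt = suc s , le , lt
Ribbon-columns (down {b = b} {w′ = w} ρ) with Ribbon-columns ρ
... | e , eq , cols = e , eq , λ c → mk⇔
  (λ { (zero , b≤c , c<b) → ℕ.≤-trans (ℕ.≤-pred (≡.subst (suc e ≤_) eq (≡.subst (suc e ≤_) (≡.sym (ℕ.+-suc e w)) (s≤s (ℕ.m≤m+n e w))))) b≤c , c<b
     ; (suc s , h) → Equivalence.to (cols c) (s , h) })
  (λ h → let s , h′ = Equivalence.from (cols c) h in suc s , h′)
Ribbon-columns (above ρ) with Ribbon-columns ρ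
... | e , eq , cols = e , eq , λ c → mk⇔
  (λ { (zero , le , lt) → contradiction (ℕ.≤-<-trans le lt) (ℕ.<-irrefl ≡.refl)
     ; (suc s , h) → Equivalence.to (cols c) (s , h) })
  (λ h → let s , h′ = Equivalence.from (cols c) h in suc s , h′)

-- Ribbons as inequalities between consecutive rows.

-- Here `f` is the outer and `g` the inner shape. The equation in `links` says that adjacent
-- occupied rows overlap in exactly one column: at least one for connectedness, at most one for the
-- absence of squares.
record Chain (i : Fin k) (f g : Fin k → ℕ) : Set where
  field
    below   : ∀ s → g s ≤ f s
    outside : ∀ s → s Fin.< i → g s ≡ f s
    head    : g i < f i
    links   : ∀ s s′ → toℕ s′ ≡ suc (toℕ s) → i Fin.≤ s → g s′ < f s′ → suc (g s) ≡ f s′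

Chain-cong : {i : Fin k} {f f′ g g′ : Fin k → ℕ} → (∀ s → f s ≡ f′ s) → (∀ s → g s ≡ g′ s) → Chain i f g → Chain i f′ g′
Chain-cong {i = i} ff gg chain = record
  { below   = λ s → ≡.subst₂ _≤_ (gg s) (ff s) (below s)
  ; outside = λ s lt → ≡.trans (≡.sym (gg s)) (≡.trans (outside s lt) (ff s))
  ; head    = ≡.subst₂ _<_ (gg i) (ff i) head
  ; links   = λ s s′ eq le lt → ≡.trans (cong suc (≡.sym (gg s)))
      (≡.trans (links s s′ eq le (≡.subst₂ _<_ (≡.sym (gg s′)) (≡.sym (ff s′)) lt)) (ff s′))
  }
  where open Chain chain

Ribbon⇒Chain : {i : Fin k} {v u : Vec ℕ k} → Ribbon i v u h w′ → Chain i (lookup v) (lookup u)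
Ribbon⇒Chain (emit _) = record
  { below   = λ { zero → ℕ.n≤1+n _ ; (suc s) → ℕ.≤-refl }
  ; outside = λ _ ()
  ; head    = ℕ.≤-refl
  ; links   = λ { s (suc s′) _ _ lt → contradiction lt (ℕ.<-irrefl ≡.refl) }
  }
Ribbon⇒Chain (left _ ρ) = record
  { below   = λ { zero → ℕ.m≤n⇒m≤1+n (below zero) ; (suc s) → below (suc s) }
  ; outside = λ _ ()
  ; head    = ℕ.m≤n⇒m≤1+n head
  ; links   = λ { s (suc s′) → links s (suc s′) }
  }
  where open Chain (Ribbon⇒Chain ρ)
Ribbon⇒Chain (down ρ) = record
  { below   = λ { zero → ℕ.n≤1+n _ ; (suc s) → below s }
  ; outside = λ _ ()
  ; head    = ℕ.≤-refl
  ; links   = λ { zero (suc zero) _ _ _ → ≡.refl ; (suc s) (suc s′) eq _ lt → links s s′ (ℕ.suc-injective eq) z≤n lt }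
  }
  where open Chain (Ribbon⇒Chain ρ)
Ribbon⇒Chain (above ρ) = record
  { below   = λ { zero → ℕ.≤-refl ; (suc s) → below s }
  ; outside = λ { zero _ → ≡.refl ; (suc s) (s≤s lt) → outside s lt }
  ; head    = head
  ; links   = λ { (suc s) (suc s′) eq (s≤s le) lt → links s s′ (ℕ.suc-injective eq) le lt }
  }
  where open Chain (Ribbon⇒Chain ρ)

private
  -- Below an empty row of a chain all rows are empty.
  settled : (l u : Vec ℕ k) → Fits b l →
            (∀ s → lookup u s ≤ lookup l s) →
            (∀ s s′ → toℕ s′ ≡ suc (toℕ s) → lookup u s′ < lookup l s′ → suc (lookup u s) ≡ lookup l s′) →
            (∀ s → toℕ s ≡ 0 → lookup u s ≡ lookup l s) → u ≡ l
  settled [] [] fit le links eq = ≡.refl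
  settled (b ∷ l) (t ∷ u) (_ ∷ fit) le links eq with eq zero ≡.refl
  ... | ≡.refl = cong (t ∷_) (settled l u fit (le ∘ suc) (λ s s′ e → links (suc s) (suc s′) (cong suc e))
    λ { zero _ → next (Fits-lookup fit zero) (le (suc zero)) (links zero (suc zero) ≡.refl) })
    where
    next : ∀ {c d} → c ≤ t → d ≤ c → (d < c → suc t ≡ c) → d ≡ c
    next c≤t d≤c f with ℕ.m≤n⇒m<n∨m≡n d≤c
    ... | inj₁ lt = contradiction (≡.subst (_≤ t) (≡.sym (f lt)) c≤t) ℕ.1+n≰n
    ... | inj₂ e  = e

-- The cases are those of `headRibbons`. If the second row is as long as the first, it loses a box
-- because `d ≤ t`, and the link to it fixes `t`. Otherwise `t = b` ends the ribbon, by `settled`,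
-- and for `t < b` the head box can be cut off, since `links` never mentions the outer length of the
-- first row.
headChain⇒Ribbon : ∀ b t (l u : Vec ℕ k) → Fits b l → Fits t u → Chain zero (lookup (b ∷ l)) (lookup (t ∷ u)) →
                   ∃₂ λ h w → Ribbon zero (b ∷ l) (t ∷ u) h w
headChain⇒Ribbon zero t l u fl fu chain = contradiction (Chain.head chain) λ ()
headChain⇒Ribbon (suc b) t l u fl fu chain with top l ℕ.≤? b
headChain⇒Ribbon (suc b) t l u fl fu chain | yes le with ℕ.m≤n⇒m<n∨m≡n (ℕ.≤-pred (Chain.head chain))
... | inj₂ ≡.refl = 0 , 0 , ≡.subst (λ z → Ribbon zero (suc b ∷ l) z 0 0) (≡.sym same) (emit le)
  where
  open Chain chain
  same : b ∷ u ≡ b ∷ l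
  same = settled (b ∷ l) (b ∷ u) (ℕ.≤-refl ∷ Fits-rebound le fl)
    (λ { zero → ℕ.≤-refl ; (suc s) → below (suc s) })
    (λ { s (suc s′) e → links s (suc s′) e z≤n })
    (λ { zero _ → ≡.refl })
... | inj₁ t<b = let h , w , ρ = headChain⇒Ribbon b t l u (Fits-rebound le fl) fu narrower in h , suc w , left le ρ
  where
  open Chain chain
  narrower : Chain zero (lookup (b ∷ l)) (lookup (t ∷ u))
  narrower = record
    { below   = λ { zero → ℕ.<⇒≤ t<b ; (suc s) → below (suc s) }
    ; outside = λ _ ()
    ; head    = t<b
    ; links   = λ { s (suc s′) → links s (suc s′) }
    }
headChain⇒Ribbon (suc b) t []      []      fl         fu         chain | no ¬le = contradiction z≤n ¬le
headChain⇒Ribbon (suc b) t (c ∷ l) (d ∷ u) (c≤ ∷ fl) (d≤t ∷ fu) chain | no c≰b with ℕ.≤-antisym c≤ (ℕ.≰⇒> c≰b)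
... | ≡.refl with ℕ.suc-injective (Chain.links chain zero (suc zero) ≡.refl z≤n (ℕ.≤-<-trans d≤t (Chain.head chain)))
...   | ≡.refl = let h , w , ρ = headChain⇒Ribbon (suc b) d l u fl fu lower-part in suc h , w , down ρ
  where
  open Chain chain
  lower-part : Chain zero (lookup (suc b ∷ l)) (lookup (d ∷ u))
  lower-part = record
    { below   = below ∘ suc
    ; outside = λ _ ()
    ; head    = s≤s d≤t
    ; links   = λ s s′ e _ → links (suc s) (suc s′) (cong suc e) z≤n
    }

Chain⇒Ribbon : (i : Fin k) (v u : Vec ℕ k) → Fits m v → Fits m u → Chain i (lookup v) (lookup u) → ∃₂ λ h w → Ribbon i v u h w
Chain⇒Ribbon zero    (b ∷ l) (t ∷ u) (_ ∷ fl) (_ ∷ fu) chain = headChain⇒Ribbon b t l u fl fu chain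
Chain⇒Ribbon (suc i) (a ∷ l) (c ∷ u) (_ ∷ fl) (_ ∷ fu) chain with Chain.outside chain zero (s≤s z≤n)
... | ≡.refl = let h , w , ρ = Chain⇒Ribbon i l u fl fu lower-part in h , w , above ρ
  where
  open Chain chain
  lower-part : Chain i (lookup l) (lookup u)
  lower-part = record
    { below   = below ∘ suc
    ; outside = λ s lt → outside (suc s) (s≤s lt)
    ; head    = head
    ; links   = λ s s′ e le → links (suc s) (suc s′) (cong suc e) (s≤s le)
    }

-- Comparison with the geometric definition of ribbons.

private
  length-filter-map : ∀ {A B : Set} {P : B → Set} (P? : Decidable P) (f : A → B) xs →
                      length (filter P? (map f xs)) ≡ length (filter (P? ∘ f) xs)
  length-filter-map P? f []       = ≡.refl
  length-filter-map P? f (x ∷ xs) with P? (f x)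
  ... | yes _ = cong suc (length-filter-map P? f xs)
  ... | no _  = length-filter-map P? f xs

count-interval : ∀ k {P : Fin k → Set} (P? : Decidable P) lo hi → lo ≤ hi → hi ≤ k →
                 (∀ r → P r ⇔ (lo ≤ toℕ r × toℕ r < hi)) → lo ℕ.+ length (filter P? (allFin k)) ≡ hi
count-interval zero    P? zero zero _ _ _ = ≡.refl
count-interval (suc k) {P} P? lo hi lo≤hi hi≤k P⇔ = begin
  lo ℕ.+ length (filter P? (zero ∷ tabulate suc))           ≡⟨ cong (λ rs → lo ℕ.+ length (filter P? (zero ∷ rs))) (List.map-tabulate id suc) ⟨
  lo ℕ.+ length (filter P? (zero ∷ map suc (allFin k)))     ≡⟨ go lo hi lo≤hi hi≤k P⇔ ⟩
  hi                                                        ∎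
  where
  open ≡.≡-Reasoning
  go : ∀ lo hi → lo ≤ hi → hi ≤ suc k → (∀ r → P r ⇔ (lo ≤ toℕ r × toℕ r < hi)) →
       lo ℕ.+ length (filter P? (zero ∷ map suc (allFin k))) ≡ hi
  go zero zero lo≤hi hi≤k P⇔ with P? zero
  ... | yes P0 = contradiction (proj₂ (Equivalence.to (P⇔ zero) P0)) λ ()
  ... | no _   = ≡.trans (length-filter-map P? suc (allFin k)) (count-interval k (P? ∘ suc) 0 0 z≤n z≤n λ r →
    mk⇔ (λ Pr → contradiction (proj₂ (Equivalence.to (P⇔ (suc r)) Pr)) λ ()) λ { (_ , ()) })
  go zero (suc hi) lo≤hi (s≤s hi≤k) P⇔ with P? zero
  ... | yes _  = cong suc (≡.trans (length-filter-map P? suc (allFin k)) (count-interval k (P? ∘ suc) 0 hi z≤n hi≤k λ r →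
    mk⇔ (λ Pr → z≤n , ℕ.≤-pred (proj₂ (Equivalence.to (P⇔ (suc r)) Pr))) λ { (_ , lt) → Equivalence.from (P⇔ (suc r)) (z≤n , s≤s lt) }))
  ... | no ¬P0 = contradiction (Equivalence.from (P⇔ zero) (z≤n , s≤s z≤n)) ¬P0
  go (suc lo) (suc hi) (s≤s lo≤hi) (s≤s hi≤k) P⇔ with P? zero
  ... | yes P0 = contradiction (proj₁ (Equivalence.to (P⇔ zero) P0)) λ ()
  ... | no _   = cong suc (≡.trans (cong (lo ℕ.+_) (length-filter-map P? suc (allFin k))) (count-interval k (P? ∘ suc) lo hi lo≤hi hi≤k λ r →
    mk⇔ (λ Pr → let le , lt = Equivalence.to (P⇔ (suc r)) Pr in ℕ.≤-pred le , ℕ.≤-pred lt)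
        λ { (le , lt) → Equivalence.from (P⇔ (suc r)) (s≤s le , s≤s lt) }))

module SkewRibbons {k m : ℕ} (μ ν : Partition k m) where
  open Skew μ ν

  private
    column : ∀ {c s} → c < row μ s → Fin m
    column {c} {s} lt = fromℕ< {c} (ℕ.<-≤-trans lt (row-bounded μ s))

    toℕ-column : ∀ {c s} (lt : c < row μ s) → toℕ (column {c} {s} lt) ≡ c
    toℕ-column lt = Fin.toℕ-fromℕ< _

    inside : ∀ {s c d} → row ν s ≤ d → d < row μ s → toℕ c ≡ d → Inside (s , c)
    inside le lt ≡.refl = le , lt

    -- A discrete intermediate value argument: the first step of the path that leaves the rows up to
    -- `s` is vertical, and its column is common to both rows.
    crossing : ∀ {s s′ b b′} → toℕ s′ ≡ suc (toℕ s) → Star Step b b′ → proj₁ b Fin.≤ s → s′ Fin.≤ proj₁ b′ →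
               ∃ λ c → Inside (s , c) × Inside (s′ , c)
    crossing {s} s′≡ ε r≤s s′≤r = contradiction (≡.subst (_≤ toℕ s) s′≡ (ℕ.≤-trans s′≤r r≤s)) ℕ.1+n≰n
    crossing {s} {s′} {r , c} s′≡ (_◅_ {j = r₁ , c₁} (in₀ , in₁ , adj) path) r≤s s′≤ with toℕ r₁ ℕ.≤? toℕ s
    ... | yes r₁≤s = crossing s′≡ path r₁≤s s′≤
    ... | no r₁≰s  = c , ≡.subst (λ z → Inside (z , c)) r≡s in₀ ,
                     ≡.subst₂ (λ z d → Inside (z , d)) r₁≡s′ (≡.sym c≡c₁) in₁
      where
      r<r₁ : toℕ r < toℕ r₁
      r<r₁ = ℕ.≤-<-trans r≤s (ℕ.≰⇒> r₁≰s)
      split : ∀ {d e} → 0 < d → d ℕ.+ e ≡ 1 → d ≡ 1 × e ≡ 0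
      split {suc zero} {zero} _ _ = ≡.refl , ≡.refl
      split {suc (suc d)} {e} _ ()
      parts : toℕ r₁ ∸ toℕ r ≡ 1 × ℕ.∣ toℕ c - toℕ c₁ ∣ ≡ 0
      parts = split (ℕ.m<n⇒0<n∸m r<r₁)
        (≡.trans (cong (ℕ._+ ℕ.∣ toℕ c - toℕ c₁ ∣) (≡.sym (ℕ.m≤n⇒∣m-n∣≡n∸m (ℕ.<⇒≤ r<r₁)))) adj)
      c≡c₁ : c ≡ c₁
      c≡c₁ = Fin.toℕ-injective (ℕ.∣m-n∣≡0⇒m≡n (proj₂ parts))
      r₁≡ : toℕ r₁ ≡ suc (toℕ r)
      r₁≡ = ≡.trans (≡.sym (ℕ.m∸n+n≡m (ℕ.<⇒≤ r<r₁))) (cong (ℕ._+ toℕ r) (proj₁ parts))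
      r≡s : r ≡ s
      r≡s = Fin.toℕ-injective (ℕ.≤-antisym r≤s (ℕ.≤-pred (≡.subst (suc (toℕ s) ≤_) r₁≡ (ℕ.≰⇒> r₁≰s))))
      r₁≡s′ : r₁ ≡ s′
      r₁≡s′ = Fin.toℕ-injective (≡.trans r₁≡ (≡.trans (cong (suc ∘ toℕ) r≡s) (≡.sym s′≡)))

  ribbon⇒Chain : ∀ {i} → RibbonWithHeadInRow i → Chain i (row μ) (row ν)
  ribbon⇒Chain {i} (R , c , in-head , extreme) = record
    { below   = contained
    ; outside = λ s s<i → ℕ.≤-antisym (contained s) (ℕ.≮⇒≥ λ lt →
        ℕ.<⇒≱ s<i (proj₁ (extreme (s , column {s = s} lt) (inside ℕ.≤-refl lt (toℕ-column {s = s} lt)))))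
    ; head    = ℕ.≤-<-trans (proj₁ in-head) (proj₂ in-head)
    ; links   = λ s s′ s′≡ i≤s lt → links′ s′≡
        (crossing s′≡ (connected (i , c) (s′ , column {s = s′} lt) in-head (inside ℕ.≤-refl lt (toℕ-column {s = s′} lt))) i≤s ℕ.≤-refl)
    }
    where
    open IsRibbon R
    -- The common column gives one inequality. If the other failed, the columns `row ν s` and
    -- `row ν s + 1` of the two rows would form a square.
    links′ : ∀ {s s′} → toℕ s′ ≡ suc (toℕ s) → (∃ λ d → Inside (s , d) × Inside (s′ , d)) → suc (row ν s) ≡ row μ s′
    links′ {s} {s′} s′≡ (d , (g≤d , _) , (_ , d<f)) = ℕ.≤-antisym g<f (ℕ.≮⇒≥ λ sg<f → no-square
        (s , column {s = s′} g<f) (s′ , column {s = s′} sg<f)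
        ( s′≡ , ≡.trans (toℕ-column {s = s′} sg<f) (cong suc (≡.sym (toℕ-column {s = s′} g<f)))
        , inside ℕ.≤-refl (ℕ.<-≤-trans g<f f′≤f) (toℕ-column {s = s′} g<f)
        , inside (ℕ.n≤1+n _) (ℕ.<-≤-trans sg<f f′≤f) (toℕ-column {s = s′} sg<f)
        , inside g′≤g g<f (toℕ-column {s = s′} g<f)
        , inside (ℕ.m≤n⇒m≤1+n g′≤g) sg<f (toℕ-column {s = s′} sg<f)))
      where
      s≤s′ : s Fin.≤ s′
      s≤s′ = ≡.subst (toℕ s ≤_) (≡.sym s′≡) (ℕ.n≤1+n _)
      g<f  = ℕ.≤-<-trans g≤d d<f
      f′≤f = row-decreasing μ s≤s′
      g′≤g = row-decreasing ν s≤s′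

  -- For connectedness every box walks to the head: right to the end of its row, then up, because by
  -- `links` the last column of a row is the first column of the row above. A square in columns c
  -- and c + 1 would need c + 1 to lie below the end of its lower row, but `links` puts that end at
  -- most at c + 1.
  Chain⇒ribbon : ∀ {i} → Chain i (row μ) (row ν) → RibbonWithHeadInRow i
  Chain⇒ribbon {i} chain = record
    { contained = below
    ; nonempty  = (i , proj₁ end) , proj₂ (proj₂ end)
    ; connected = λ b b′ in-b in-b′ → to-head b in-b ◅◅ Star.reverse step-sym (to-head b′ in-b′)
    ; no-square = λ { (r , c) (r′ , c′) (r′≡ , c′≡ , in-b , _ , _ , in-b′) →
        contradiction (≡.subst₂ _<_ c′≡ (≡.sym (links r r′ r′≡ (after in-b) (ℕ.≤-<-trans (proj₁ in-b′) (proj₂ in-b′)))) (proj₂ in-b′))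
          (ℕ.≤⇒≯ (s≤s (proj₁ in-b))) }
    } , proj₁ end , proj₂ (proj₂ end) ,
    λ { (r , c) in-b → after in-b , ℕ.≤-pred (≡.subst (toℕ c <_) (≡.sym (proj₁ (proj₂ end))) (ℕ.<-≤-trans (proj₂ in-b) (row-decreasing μ (after in-b)))) }
    where
    open Chain chain

    after : ∀ {s c} → Inside (s , c) → i Fin.≤ s
    after {s} (le , lt) = ℕ.≮⇒≥ λ s<i → ℕ.<-irrefl (outside s s<i) (ℕ.≤-<-trans le lt)

    rowEnd : ∀ s → row ν s < row μ s → ∃ λ c → suc (toℕ c) ≡ row μ s × Inside (s , c)
    rowEnd s lt with row μ s in eq
    ... | suc d = column {s = s} d< , cong suc (toℕ-column {s = s} d<) ,
                  ≡.subst (row ν s ≤_) (≡.sym (toℕ-column {s = s} d<)) (ℕ.≤-pred lt) ,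
                  ≡.subst (_≤ suc d) (cong suc (≡.sym (toℕ-column {s = s} d<))) ℕ.≤-refl
      where
      d< : d < row μ s
      d< = ≡.subst (d <_) (≡.sym eq) ℕ.≤-refl

    end = rowEnd i head

    step-sym : ∀ {b b′} → Step b b′ → Step b′ b
    step-sym {r , c} {r′ , c′} (in₀ , in₁ , adj) =
      in₁ , in₀ , ≡.trans (cong₂ ℕ._+_ (ℕ.∣-∣-comm (toℕ r′) (toℕ r)) (ℕ.∣-∣-comm (toℕ c′) (toℕ c))) adj

    along-row : ∀ {s} d c c′ → toℕ c ℕ.+ d ≡ toℕ c′ → Inside (s , c) → Inside (s , c′) → Star Step (s , c) (s , c′)
    along-row zero    c c′ eq in₀ in₁ with Fin.toℕ-injective (≡.trans (≡.sym (ℕ.+-identityʳ (toℕ c))) eq)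
    ... | ≡.refl = ε
    along-row {s} (suc d) c c′ eq in₀ in₁ = (in₀ , in₂ , adj) ◅ along-row d c₂ c′ (≡.trans (cong (ℕ._+ d) c₂≡) eq′) in₂ in₁
      where
      eq′ : suc (toℕ c) ℕ.+ d ≡ toℕ c′
      eq′ = ≡.trans (≡.sym (ℕ.+-suc (toℕ c) d)) eq
      c₂< : suc (toℕ c) < row μ s
      c₂< = ℕ.≤-<-trans (≡.subst (suc (toℕ c) ≤_) eq′ (ℕ.m≤m+n _ d)) (proj₂ in₁)
      c₂ = column {s = s} c₂<
      c₂≡ = toℕ-column {s = s} c₂<
      in₂ : Inside (s , c₂)
      in₂ = inside (ℕ.m≤n⇒m≤1+n (proj₁ in₀)) c₂< c₂≡
      adj : Adjacent (s , c) (s , c₂)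
      adj = cong₂ ℕ._+_ (ℕ.∣n-n∣≡0 (toℕ s)) (≡.trans (cong ℕ.∣ toℕ c -_∣ c₂≡)
        (≡.trans (ℕ.m≤n⇒∣m-n∣≡n∸m (ℕ.n≤1+n (toℕ c))) (ℕ.m+n∸n≡m 1 (toℕ c))))

    climb : ∀ d s c → toℕ s ≡ toℕ i ℕ.+ d → Inside (s , c) → Star Step (s , c) (i , proj₁ end)
    climb zero s c eq in-b with Fin.toℕ-injective (≡.trans eq (ℕ.+-identityʳ (toℕ i)))
    ... | ≡.refl = along-row (toℕ (proj₁ end) ∸ toℕ c) c _
      (ℕ.m+[n∸m]≡n (ℕ.≤-pred (≡.subst (toℕ c <_) (≡.sym (proj₁ (proj₂ end))) (proj₂ in-b)))) in-b (proj₂ (proj₂ end))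
    climb (suc d) zero c eq in-b = contradiction (≡.trans eq (ℕ.+-suc (toℕ i) d)) λ ()
    climb (suc d) (suc s₁) c eq in-b =
      along-row (toℕ e ∸ toℕ c) c e (ℕ.m+[n∸m]≡n (ℕ.≤-pred (≡.subst (toℕ c <_) (≡.sym e≡) (proj₂ in-b)))) in-b in-e
      ◅◅ (in-e , in-e₀ , adj) ◅ climb d s₀ e s₀≡i+d in-e₀
      where
      r = suc s₁
      s₀ = Fin.inject₁ s₁
      s₀≡ : toℕ r ≡ suc (toℕ s₀)
      s₀≡ = cong suc (≡.sym (Fin.toℕ-inject₁ s₁))
      s₀≡i+d : toℕ s₀ ≡ toℕ i ℕ.+ d
      s₀≡i+d = ℕ.suc-injective (≡.trans (≡.sym s₀≡) (≡.trans eq (ℕ.+-suc (toℕ i) d)))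
      i≤s₀ : i Fin.≤ s₀
      i≤s₀ = ≡.subst (toℕ i ≤_) (≡.sym s₀≡i+d) (ℕ.m≤m+n _ d)
      lt : row ν r < row μ r
      lt = ℕ.≤-<-trans (proj₁ in-b) (proj₂ in-b)
      e = proj₁ (rowEnd r lt)
      e≡ = proj₁ (proj₂ (rowEnd r lt))
      in-e = proj₂ (proj₂ (rowEnd r lt))
      in-e₀ : Inside (s₀ , e)
      in-e₀ = ℕ.≤-reflexive (ℕ.suc-injective (≡.trans (links s₀ r s₀≡ i≤s₀ lt) (≡.sym e≡)))
        , ℕ.<-≤-trans (proj₂ in-e) (row-decreasing μ (≡.subst (toℕ s₀ ≤_) (≡.sym s₀≡) (ℕ.n≤1+n _)))
      adj : Adjacent (r , e) (s₀ , e)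
      adj = cong₂ ℕ._+_ (≡.trans (cong ℕ.∣_- toℕ s₀ ∣ s₀≡) (≡.trans (ℕ.m≤n⇒∣n-m∣≡n∸m (ℕ.n≤1+n (toℕ s₀))) (ℕ.m+n∸n≡m 1 (toℕ s₀)))) (ℕ.∣n-n∣≡0 (toℕ e))

    to-head : ∀ b → Inside b → Star Step b (i , proj₁ end)
    to-head (s , c) in-b = climb (toℕ s ∸ toℕ i) s c (≡.sym (ℕ.m+[n∸m]≡n (after in-b))) in-b

  private
    lookup-< : ∀ r → lookup (rows ν) r < lookup (rows μ) r ⇔ row ν r < row μ r
    lookup-< r = mk⇔ (≡.subst₂ _<_ (lookup-rows ν r) (lookup-rows μ r)) (≡.subst₂ _<_ (≡.sym (lookup-rows ν r)) (≡.sym (lookup-rows μ r)))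

  ht-Ribbon : ∀ {i h w} → Ribbon i (rows μ) (rows ν) h w → ht ≡ suc h
  ht-Ribbon {i} {h} ρ = ℕ.+-cancelˡ-≡ (toℕ i) _ _
    (count-interval k _ (toℕ i) (toℕ i ℕ.+ suc h) (ℕ.m≤m+n _ _) (Ribbon-height ρ) λ r → mk⇔
      (λ (c , le , lt) → Equivalence.to (Ribbon-rows ρ r) (Equivalence.from (lookup-< r) (ℕ.≤-<-trans le lt)))
      (λ h → let lt = Equivalence.to (lookup-< r) (Equivalence.from (Ribbon-rows ρ r) h)
             in column {s = r} lt , inside ℕ.≤-refl lt (toℕ-column {s = r} lt)))

  wd-Ribbon : ∀ {i h w} → Ribbon i (rows μ) (rows ν) h w → wd ≡ suc w
  wd-Ribbon {i} ρ with Ribbon-columns ρ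
  ... | e , eq , cols = ℕ.+-cancelˡ-≡ e _ _ (≡.trans
    (count-interval m _ e (lookup (rows μ) i) (≡.subst (e ≤_) eq (ℕ.m≤m+n e _)) (Fits-lookup (rows-fit μ) i) λ c → mk⇔
      (λ (r , le , lt) → Equivalence.to (cols (toℕ c))
        (r , ≡.subst (_≤ toℕ c) (≡.sym (lookup-rows ν r)) le , ≡.subst (toℕ c <_) (≡.sym (lookup-rows μ r)) lt))
      (λ h → let r , le , lt = Equivalence.from (cols (toℕ c)) h
             in r , ≡.subst (_≤ toℕ c) (lookup-rows ν r) le , ≡.subst (toℕ c <_) (lookup-rows μ r) lt))
    (≡.sym eq))

  ribbon⇒Ribbon : ∀ {i} → RibbonWithHeadInRow i → Ribbon i (rows μ) (rows ν) (ht ∸ 1) (wd ∸ 1)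
  ribbon⇒Ribbon {i} R with Chain⇒Ribbon i (rows μ) (rows ν) (rows-fit μ) (rows-fit ν)
    (Chain-cong (≡.sym ∘ lookup-rows μ) (≡.sym ∘ lookup-rows ν) (ribbon⇒Chain R))
  ... | h , w , ρ = ≡.subst₂ (Ribbon i (rows μ) (rows ν)) (cong (_∸ 1) (≡.sym (ht-Ribbon ρ))) (cong (_∸ 1) (≡.sym (wd-Ribbon ρ))) ρ

  Ribbon⇒ribbon : ∀ {i h w} → Ribbon i (rows μ) (rows ν) h w → RibbonWithHeadInRow i
  Ribbon⇒ribbon ρ = Chain⇒ribbon (Chain-cong (lookup-rows μ) (lookup-rows ν) (Ribbon⇒Chain ρ))

weigh : Partition k m → Partition k m → Weighted k
weigh μ ν = Skew.ht μ ν ∸ 1 , Skew.wd μ ν ∸ 1 , rows ν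

-- One enumeration filters all partitions, the other follows the rim, so their orders are unrelated;
-- duplicate-free lists with the same members are permutations of each other.
ribbons-↭ : (i : Fin k) (μ : Partition k m) →
            map (weigh μ) (filter (λ ν → Skew.ribbonWithHeadInRow? μ ν i) (partitions k m)) ↭ ribbons i (rows μ)
ribbons-↭ {k} {m} i μ = ∼bag⇒↭ (unique∧set⇒bag
  (Unique.map⁺ (rows-injective ∘ cong (proj₂ ∘ proj₂)) (Unique.filter⁺ ribbon? (partitions-unique k m)))
  (ribbons-unique i (rows μ))
  (mk⇔ to from))
  where
  ribbon? = λ ν → Skew.ribbonWithHeadInRow? μ ν i
  to : ∀ {e} → e ∈ map (weigh μ) (filter ribbon? (partitions k m)) → e ∈ ribbons i (rows μ)
  to e∈ with ∈.∈-map⁻ (weigh μ) e∈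
  ... | ν , ν∈ , ≡.refl = ribbons-complete (SkewRibbons.ribbon⇒Ribbon μ ν (proj₂ (∈.∈-filter⁻ ribbon? {xs = partitions k m} ν∈)))
  from : ∀ {e} → e ∈ ribbons i (rows μ) → e ∈ map (weigh μ) (filter ribbon? (partitions k m))
  from {h , w , u} e∈ with ρ ← ribbons-sound i (rows μ) (rows-fit μ) e∈ with fromRows (Ribbon-fits (rows-fit μ) ρ)
  ... | ν , ≡.refl = ≡.subst (_∈ map (weigh μ) (filter ribbon? (partitions k m)))
    (cong₂ (λ h w → h , w , rows ν) (cong (_∸ 1) (SkewRibbons.ht-Ribbon μ ν ρ)) (cong (_∸ 1) (SkewRibbons.wd-Ribbon μ ν ρ)))
    (∈.∈-map⁺ (weigh μ) (∈.∈-filter⁺ ribbon? (partitions-complete ν) (SkewRibbons.Ribbon⇒ribbon μ ν ρ)))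

-- Commutation relations for descending runs.

-- S a plays the role of T̄ with 0-based index a.  For a outside the range
-- suc a < n it is only required to commute with what it should.
record AffineHecke (A : Ring 0ℓ 0ℓ) (n : ℕ) : Set where
  open Ring A
  field
    p q ħ     : Carrier
    S X       : ℕ → Carrier
    p-central : ∀ y → p * y ≈ y * p
    q-central : ∀ y → q * y ≈ y * q
    ħ-central : ∀ y → ħ * y ≈ y * ħ
    quadratic : ∀ {a} → suc a < n → S a * S a ≈ (p - q) * S a + p * q
    braid     : ∀ {a} → suc (suc a) < n → S a * (S (suc a) * S a) ≈ S (suc a) * (S a * S (suc a))
    far       : ∀ {a b} → suc a < b → S a * S b ≈ S b * S a
    S-X       : ∀ {a b} → b ≢ a → b ≢ suc a → S a * X b ≈ X b * S a
    S-X-lo    : ∀ {a} → suc a < n → S a * X a ≈ X (suc a) * S a + (ħ - (p - q) * X (suc a))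

module AffineHeckeProperties {A : Ring 0ℓ 0ℓ} {n : ℕ} (H : AffineHecke A n) where
  open RingOps A hiding (zero)
  open AffineHecke H
  open import Algebra.Properties.Ring A using (-‿distribˡ-*; -‿distribʳ-*; -‿+-comm; -‿involutive)
  open import Algebra.Properties.CommutativeSemigroup (CommutativeMonoid.commutativeSemigroup +-commutativeMonoid) using (interchange)
  open import Relation.Binary.Reasoning.Setoid setoid

  private variable
    c d y z : Carrier

  commute-past : c * d ≈ d * c → c * (d * y) ≈ d * (c * y)
  commute-past cd = trans (sym (*-assoc _ _ _)) (trans (*-congʳ cd) (*-assoc _ _ _))

  commute-- : c * y ≈ y * c → d * y ≈ y * d → (c - d) * y ≈ y * (c - d)
  commute-- {c} {y} {d} cy dy = begin
    (c - d) * y       ≈⟨ distribʳ _ _ _ ⟩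
    c * y + - d * y   ≈⟨ +-cong cy (trans (sym (-‿distribˡ-* _ _)) (trans (-‿cong dy) (-‿distribʳ-* _ _))) ⟩
    y * c + y * - d   ≈⟨ distribˡ _ _ _ ⟨
    y * (c - d)       ∎

  commute-* : c * y ≈ y * c → d * y ≈ y * d → (c * d) * y ≈ y * (c * d)
  commute-* {c} {y} {d} cy dy = begin
    (c * d) * y   ≈⟨ *-assoc _ _ _ ⟩
    c * (d * y)   ≈⟨ *-congˡ dy ⟩
    c * (y * d)   ≈⟨ *-assoc _ _ _ ⟨
    (c * y) * d   ≈⟨ *-congʳ cy ⟩
    (y * c) * d   ≈⟨ *-assoc _ _ _ ⟩
    y * (c * d)   ∎

  distribʳ-- : (c - d) * y ≈ c * y - d * y
  distribʳ-- = trans (distribʳ _ _ _) (+-congˡ (sym (-‿distribˡ-* _ _)))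

  distribˡ-- : y * (c - d) ≈ y * c - y * d
  distribˡ-- = trans (distribˡ _ _ _) (+-congˡ (sym (-‿distribʳ-* _ _)))

  far′ : suc a < b → S b * S a ≈ S a * S b
  far′ lt = sym (far lt)

  [p-q] : Carrier
  [p-q] = p - q

  [p-q]-central : ∀ y → [p-q] * y ≈ y * [p-q]
  [p-q]-central y = commute-- (p-central y) (q-central y)

  κ : ℕ → Carrier
  κ j = ħ - [p-q] * X j

  S-κ : b ≢ a → b ≢ suc a → κ b * S a ≈ S a * κ b
  S-κ ≢a ≢sa = commute-- (ħ-central _) (commute-* ([p-q]-central _) (sym (S-X ≢a ≢sa)))

  -- So a κ created on the way up drags T = S - (p - q) behind it, which acts by q on Fixed elements.
  S-κ-lo : suc a < n → S a * κ a ≈ κ (suc a) * (S a - [p-q])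
  S-κ-lo {a} lt = begin
    S a * (ħ - [p-q] * X a)                                        ≈⟨ distribˡ-- ⟩
    S a * ħ - S a * ([p-q] * X a)                                  ≈⟨ +-cong (sym (ħ-central _)) (-‿cong (commute-past (sym ([p-q]-central _)))) ⟩
    ħ * S a - [p-q] * (S a * X a)                                  ≈⟨ +-congˡ (-‿cong (*-congˡ (S-X-lo lt))) ⟩
    ħ * S a - [p-q] * (X (suc a) * S a + κ (suc a))                ≈⟨ +-congˡ (-‿cong (distribˡ _ _ _)) ⟩
    ħ * S a - ([p-q] * (X (suc a) * S a) + [p-q] * κ (suc a))          ≈⟨ +-congˡ (-‿+-comm _ _) ⟨
    ħ * S a + (- ([p-q] * (X (suc a) * S a)) + - ([p-q] * κ (suc a)))  ≈⟨ +-assoc _ _ _ ⟨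
    (ħ * S a - [p-q] * (X (suc a) * S a)) - [p-q] * κ (suc a)          ≈⟨ +-cong (+-congˡ (-‿cong (*-assoc _ _ _))) (-‿cong (sym ([p-q]-central _))) ⟨
    (ħ * S a - ([p-q] * X (suc a)) * S a) - κ (suc a) * [p-q]          ≈⟨ +-congʳ distribʳ-- ⟨
    κ (suc a) * S a - κ (suc a) * [p-q]                            ≈⟨ distribˡ-- ⟨
    κ (suc a) * (S a - [p-q])                                      ∎

  Fixed : ℕ → Carrier → Set
  Fixed a y = S a * y ≈ p * y

  Fixed-resp : y ≈ z → Fixed a y → Fixed a z
  Fixed-resp eq fix = trans (*-congˡ (sym eq)) (trans fix (*-congˡ eq))

  Fixed-* : c * S a ≈ S a * c → Fixed a y → Fixed a (c * y)
  Fixed-* cS fix = trans (sym (commute-past cS)) (trans (*-congˡ fix) (sym (commute-past (p-central _))))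

  Fixed-+ : Fixed a y → Fixed a z → Fixed a (y + z)
  Fixed-+ fy fz = trans (distribˡ _ _ _) (trans (+-cong fy fz) (sym (distribˡ _ _ _)))

  S-[p-q]-fixed : Fixed a y → (S a - [p-q]) * y ≈ q * y
  S-[p-q]-fixed {a} {y} fix = begin
    (S a - [p-q]) * y                    ≈⟨ distribʳ-- ⟩
    S a * y - [p-q] * y                  ≈⟨ +-cong fix (-‿cong distribʳ--) ⟩
    p * y - (p * y - q * y)          ≈⟨ +-congˡ (-‿+-comm _ _) ⟨
    p * y + (- (p * y) - - (q * y))  ≈⟨ +-assoc _ _ _ ⟨
    (p * y - p * y) - - (q * y)      ≈⟨ +-cong (-‿inverseʳ _) (-‿involutive _) ⟩
    0# + q * y                       ≈⟨ +-identityˡ _ ⟩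
    q * y                            ∎

  -- The run S_{j+t-1} ⋯ S_j as an operator instead of a product: nested application needs no
  -- reassociation.
  up : ℕ → ℕ → Carrier → Carrier
  up j zero    y = y
  up j (suc t) y = S (j ℕ.+ t) * up j t y

  up-cong : ∀ j t → y ≈ z → up j t y ≈ up j t z
  up-cong j zero    eq = eq
  up-cong j (suc t) eq = *-congˡ (up-cong j t eq)

  up-0 : ∀ j t → up j t 0# ≈ 0#
  up-0 j zero    = refl
  up-0 j (suc t) = trans (*-congˡ (up-0 j t)) (zeroʳ _)

  up-+ : ∀ j t → up j t (y + z) ≈ up j t y + up j t z
  up-+ j zero    = refl
  up-+ j (suc t) = trans (*-congˡ (up-+ j t)) (distribˡ _ _ _)

  up-commute : ∀ j t → (∀ {a} → j ≤ a → a < j ℕ.+ t → c * S a ≈ S a * c) → up j t (c * y) ≈ c * up j t y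
  up-commute j zero    h = refl
  up-commute j (suc t) h = trans
    (*-congˡ (up-commute j t λ j≤a lt → h j≤a (ℕ.<-≤-trans lt (ℕ.+-monoʳ-≤ j (ℕ.n≤1+n t)))))
    (sym (commute-past (h (ℕ.m≤m+n j t) (ℕ.+-monoʳ-< j (ℕ.n<1+n t)))))

  up-central : ∀ j t → (∀ y → c * y ≈ y * c) → up j t (c * y) ≈ c * up j t y
  up-central j t central = up-commute j t λ _ _ → central _

  up-S-above : ∀ j t → j ℕ.+ t < a → up j t (S a * y) ≈ S a * up j t y
  up-S-above j t lt = up-commute j t λ _ b< → far′ (ℕ.≤-<-trans b< lt)

  up-S-below : ∀ j t → suc a < j → up j t (S a * y) ≈ S a * up j t y
  up-S-below j t lt = up-commute j t λ j≤b _ → far (ℕ.<-≤-trans lt j≤b)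

  up-X-below : ∀ j t → a < j → up j t (X a * y) ≈ X a * up j t y
  up-X-below j t lt = up-commute j t λ j≤b _ →
    sym (S-X (ℕ.<⇒≢ (ℕ.<-≤-trans lt j≤b)) (ℕ.<⇒≢ (ℕ.<-≤-trans lt (ℕ.m≤n⇒m≤1+n j≤b))))

  up-shift : ∀ j t → up j (suc t) y ≈ up (suc j) t (S j * y)
  up-shift j zero    = *-congʳ (reflexive (≡.cong S (ℕ.+-identityʳ j)))
  up-shift j (suc t) = *-cong (reflexive (≡.cong S (ℕ.+-suc j t))) (up-shift j t)

  -- S_a commutes with the letters above a + 1, the braid relation at the letters a + 1 and a turns
  -- it into S_{a+1}, and this commutes with the letters below a.
  up-braid : ∀ j t → j ℕ.+ t < n → j ≤ a → suc a < j ℕ.+ t → S a * up j t y ≈ up j t (S (suc a) * y)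
  up-braid {a} j zero _ j≤a sa< = contradiction (ℕ.<-≤-trans sa< (ℕ.≤-reflexive (ℕ.+-identityʳ j))) (ℕ.≤⇒≯ (ℕ.m≤n⇒m≤1+n j≤a))
  up-braid {a} {y} j (suc t) jt<n j≤a sa< with ℕ.m≤n⇒m<n∨m≡n (ℕ.≤-pred (≡.subst (suc a <_) (ℕ.+-suc j t) sa<))
  ... | inj₁ lt = begin
    S a * (S (j ℕ.+ t) * up j t y)       ≈⟨ commute-past (far lt) ⟩
    S (j ℕ.+ t) * (S a * up j t y)       ≈⟨ *-congˡ (up-braid j t (ℕ.<-trans (ℕ.+-monoʳ-< j (ℕ.n<1+n t)) jt<n) j≤a lt) ⟩
    S (j ℕ.+ t) * up j t (S (suc a) * y) ∎
  up-braid {a} {y} j (suc zero) jt<n j≤a sa< | inj₂ eq = contradiction (≡.subst (a <_) (≡.trans eq (ℕ.+-identityʳ j)) ℕ.≤-refl) (ℕ.≤⇒≯ j≤a)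
  up-braid {a} {y} j (suc (suc t)) jt<n j≤a sa< | inj₂ eq
    with ℕ.suc-injective (≡.trans eq (ℕ.+-suc j t))
  ... | ≡.refl rewrite ℕ.+-suc j t | ℕ.+-suc j (suc t) | ℕ.+-suc j t = begin
    S a * (S (suc a) * (S a * up j t y))  ≈⟨ trans (*-assoc _ _ _) (*-congˡ (*-assoc _ _ _)) ⟨
    (S a * (S (suc a) * S a)) * up j t y  ≈⟨ *-congʳ (braid jt<n) ⟩
    (S (suc a) * (S a * S (suc a))) * up j t y ≈⟨ trans (*-assoc _ _ _) (*-congˡ (*-assoc _ _ _)) ⟩
    S (suc a) * (S a * (S (suc a) * up j t y)) ≈⟨ *-congˡ (*-congˡ (up-S-above j t ℕ.≤-refl)) ⟨
    S (suc a) * (S a * up j t (S (suc a) * y)) ∎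

  Fixed-up-above : ∀ j t → j ℕ.+ t < a → Fixed a y → Fixed a (up j t y)
  Fixed-up-above j t lt fix = trans (sym (up-S-above j t lt)) (trans (up-cong j t fix) (up-central j t p-central))

  Fixed-up-below : ∀ j t → suc a < j → Fixed a y → Fixed a (up j t y)
  Fixed-up-below j t lt fix = trans (sym (up-S-below j t lt)) (trans (up-cong j t fix) (up-central j t p-central))

  Fixed-up-within : ∀ j t → j ℕ.+ t < n → j ≤ a → suc a < j ℕ.+ t → Fixed (suc a) y → Fixed a (up j t y)
  Fixed-up-within j t jt<n j≤a lt fix = trans (up-braid j t jt<n j≤a lt) (trans (up-cong j t fix) (up-central j t p-central))

  -- σ j b y = Σ_{t < b} q^(b-1-t) S_{j+t-1} ⋯ S_j y
  σ : ℕ → ℕ → Carrier → Carrier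
  σ j zero    y = 0#
  σ j (suc b) y = up j b y + q * σ j b y

  σ-cong : ∀ j b → y ≈ z → σ j b y ≈ σ j b z
  σ-cong j zero    eq = refl
  σ-cong j (suc b) eq = +-cong (up-cong j b eq) (*-congˡ (σ-cong j b eq))

  Fixed-σ-above : ∀ j b → j ℕ.+ b ≤ a → Fixed a y → Fixed a (σ j b y)
  Fixed-σ-above j zero    le fix = trans (zeroʳ _) (sym (zeroʳ _))
  Fixed-σ-above {a = a} j (suc b) le fix = Fixed-+ (Fixed-up-above j b lt fix) (Fixed-* (q-central _) (Fixed-σ-above j b (ℕ.<⇒≤ lt) fix))
    where lt = ≡.subst (_≤ a) (ℕ.+-suc j b) le

  -- Each new letter S_{j+b} creates one correction term and multiplies the earlier ones by q: the
  -- letters in `σ j b` are at most j + b - 2, so S_{j+b} passes them and acts on `y` by p.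
  up-X : ∀ j b → j ℕ.+ b < n → (∀ {a} → j < a → a < j ℕ.+ b → Fixed a y) →
         up j b (X j * y) ≈ X (j ℕ.+ b) * up j b y + κ (j ℕ.+ b) * σ j b y
  up-X j zero _ _ = begin
    X j * _                                    ≈⟨ *-congʳ (reflexive (≡.cong X (ℕ.+-identityʳ j))) ⟨
    X (j ℕ.+ 0) * _                            ≈⟨ +-identityʳ _ ⟨
    X (j ℕ.+ 0) * _ + 0#                       ≈⟨ +-congˡ (zeroʳ _) ⟨
    X (j ℕ.+ 0) * _ + κ (j ℕ.+ 0) * 0#         ∎
  up-X {y} j (suc b) jb<n fix rewrite ℕ.+-suc j b = begin
    S e * up j b (X j * y)                                      ≈⟨ *-congˡ (up-X j b (ℕ.<-trans (ℕ.n<1+n e) jb<n) (λ j<c c<e → fix j<c (ℕ.m≤n⇒m≤1+n c<e))) ⟩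
    S e * (X e * u + κ e * r)                                   ≈⟨ distribˡ _ _ _ ⟩
    S e * (X e * u) + S e * (κ e * r)                           ≈⟨ +-cong (*-assoc _ _ _) (*-assoc _ _ _) ⟨
    (S e * X e) * u + (S e * κ e) * r                           ≈⟨ +-cong (*-congʳ (S-X-lo jb<n)) (*-congʳ (S-κ-lo jb<n)) ⟩
    (X (suc e) * S e + κ (suc e)) * u + (κ (suc e) * (S e - [p-q])) * r
                                                                ≈⟨ +-cong (trans (distribʳ _ _ _) (+-congʳ (*-assoc _ _ _))) (trans (*-assoc _ _ _) (*-congˡ (S-[p-q]-σ b fix))) ⟩
    (X (suc e) * (S e * u) + κ (suc e) * u) + κ (suc e) * (q * r)
                                                                ≈⟨ trans (+-assoc _ _ _) (+-congˡ (sym (distribˡ _ _ _))) ⟩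
    X (suc e) * (S e * u) + κ (suc e) * (u + q * r)             ∎
    where
    e = j ℕ.+ b
    u = up j b y
    r = σ j b y
    -- For `b = 0` the letter is S_j, about which nothing is assumed, but then the sum is empty.
    S-[p-q]-σ : ∀ b → (∀ {a} → j < a → a < suc (j ℕ.+ b) → Fixed a y) → (S (j ℕ.+ b) - [p-q]) * σ j b y ≈ q * σ j b y
    S-[p-q]-σ zero    fix = trans (zeroʳ _) (sym (zeroʳ _))
    S-[p-q]-σ (suc b) fix = S-[p-q]-fixed (Fixed-σ-above j (suc b) ℕ.≤-refl (fix (ℕ.m<m+n j ℕ.z<s) ℕ.≤-refl))

  -- By `up-braid` each letter of the inner run leaves the outer run on the left with its index
  -- lowered by one.
  up-up : ∀ i t r → i ℕ.+ suc t < n → r ≤ t → up i (suc t) (up (suc i) r y) ≈ up i r (up i (suc t) y)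
  up-up i t zero    lt le = refl
  up-up {y} i t (suc r) lt le = begin
    up i (suc t) (S (suc i ℕ.+ r) * up (suc i) r y)  ≈⟨ up-braid i (suc t) lt (ℕ.m≤m+n i r) (≡.subst (suc (i ℕ.+ r) <_) (≡.sym (ℕ.+-suc i t)) (s≤s (ℕ.+-monoʳ-< i le))) ⟨
    S (i ℕ.+ r) * up i (suc t) (up (suc i) r y)      ≈⟨ *-congˡ (up-up i t r lt (ℕ.<⇒≤ le)) ⟩
    S (i ℕ.+ r) * up i r (up i (suc t) y)            ∎

  -- For `t = b` the inner run slides out, and the remaining long run has S_i next to `y`, which
  -- gives p. For smaller `t` the top letter of the long run commutes with the short run and joins
  -- the run that starts at i + 1.
  up-up-fixed : ∀ i b t → i ℕ.+ suc b < n → t ≤ b → Fixed i y →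
                up i (suc b) (up (suc i) t y) ≈ p * up i t (up (suc i) b y)
  up-up-fixed {y} i b t lt t≤b fix with ℕ.m≤n⇒m<n∨m≡n t≤b
  ... | inj₂ ≡.refl = begin
    up i (suc t) (up (suc i) t y)   ≈⟨ up-up i t t lt ℕ.≤-refl ⟩
    up i t (up i (suc t) y)         ≈⟨ up-cong i t (trans (up-shift i t) (trans (up-cong (suc i) t fix) (up-central (suc i) t p-central))) ⟩
    up i t (p * up (suc i) t y)     ≈⟨ up-central i t p-central ⟩
    p * up i t (up (suc i) t y)     ∎
  up-up-fixed {y} i (suc b) t lt t≤b fix | inj₁ (s≤s t≤b′) = begin
    S (i ℕ.+ suc b) * up i (suc b) (up (suc i) t y)       ≈⟨ *-congˡ (up-up-fixed i b t (ℕ.<-trans (ℕ.+-monoʳ-< i (ℕ.n<1+n (suc b))) lt) t≤b′ fix) ⟩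
    S (i ℕ.+ suc b) * (p * up i t (up (suc i) b y))       ≈⟨ commute-past (sym (p-central _)) ⟩
    p * (S (i ℕ.+ suc b) * up i t (up (suc i) b y))       ≈⟨ *-congˡ (up-S-above i t (ℕ.+-monoʳ-< i (s≤s t≤b′))) ⟨
    p * up i t (S (i ℕ.+ suc b) * up (suc i) b y)         ≈⟨ *-congˡ (up-cong i t (*-congʳ (reflexive (≡.cong S (ℕ.+-suc i b))))) ⟩
    p * up i t (S (suc i ℕ.+ b) * up (suc i) b y)         ∎

  -- This is where a ribbon passes to the next row, at the cost of a factor p.
  up-σ-fixed : ∀ i b → i ℕ.+ suc b < n → Fixed i y →
               up i (suc b) (σ (suc i) (suc b) y) ≈ p * σ i (suc b) (up (suc i) b y)
  up-σ-fixed {y} i b lt fix = go (suc b) ℕ.≤-refl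
    where
    go : ∀ c → c ≤ suc b → up i (suc b) (σ (suc i) c y) ≈ p * σ i c (up (suc i) b y)
    go zero    le = trans (up-0 i (suc b)) (sym (zeroʳ _))
    go (suc c) le = begin
      up i (suc b) (up (suc i) c y + q * σ (suc i) c y)                ≈⟨ up-+ i (suc b) ⟩
      up i (suc b) (up (suc i) c y) + up i (suc b) (q * σ (suc i) c y) ≈⟨ +-cong (up-up-fixed i b c lt (ℕ.≤-pred le) fix) (up-central i (suc b) q-central) ⟩
      p * up i c (up (suc i) b y) + q * up i (suc b) (σ (suc i) c y)   ≈⟨ +-congˡ (*-congˡ (go c (ℕ.<⇒≤ le))) ⟩
      p * up i c (up (suc i) b y) + q * (p * σ i c (up (suc i) b y))   ≈⟨ +-congˡ (commute-past (q-central _)) ⟩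
      p * up i c (up (suc i) b y) + p * (q * σ i c (up (suc i) b y))   ≈⟨ distribˡ _ _ _ ⟨
      p * σ i (suc c) (up (suc i) b y)                                 ∎

  -- For the largest `a` the two longest runs combine to (S_a + q) u, which S_a - p annihilates; in
  -- the other runs all letters are at least two below `a`, so S_a reaches `y`. For smaller `a` the
  -- longest run turns S_a into S_{a+1} acting on `y`, and the shorter runs are covered by
  -- induction.
  Fixed-σ-within : ∀ o t → o ℕ.+ t < n → (∀ {a} → o < a → a < o ℕ.+ t → Fixed a y) →
                   o ≤ a → a < o ℕ.+ t → Fixed a (σ o (suc t) y)
  Fixed-σ-within {a = a} o zero lt fix o≤a a< = contradiction (≡.subst (a <_) (ℕ.+-identityʳ o) a<) (ℕ.≤⇒≯ o≤a)
  Fixed-σ-within {y} {a} o (suc t) lt fix o≤a a< rewrite ℕ.+-suc o t with ℕ.m≤n⇒m<n∨m≡n (ℕ.≤-pred a<)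
  ... | inj₁ a<ot = Fixed-+
    (Fixed-up-within o (suc t) (≡.subst (_< n) (≡.sym (ℕ.+-suc o t)) lt) o≤a (≡.subst (suc a <_) (≡.sym (ℕ.+-suc o t)) (s≤s a<ot)) (fix (s≤s o≤a) (s≤s a<ot)))
    (Fixed-* (q-central _) (Fixed-σ-within o t (ℕ.<-trans (ℕ.n<1+n _) lt) (λ o<c c< → fix o<c (ℕ.m≤n⇒m≤1+n c<)) o≤a a<ot))
  ... | inj₂ ≡.refl = begin
    S a * (S a * u + q * (u + q * r))                  ≈⟨ distribˡ _ _ _ ⟩
    S a * (S a * u) + S a * (q * (u + q * r))          ≈⟨ +-cong (sym (*-assoc _ _ _)) (commute-past (sym (q-central _))) ⟩
    (S a * S a) * u + q * (S a * (u + q * r))          ≈⟨ +-cong (trans (*-congʳ (quadratic lt)) (distribʳ _ _ _)) (*-congˡ (distribˡ _ _ _)) ⟩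
    ([p-q] * S a * u + p * q * u) + q * (S a * u + S a * (q * r)) ≈⟨ +-cong (+-cong (trans (*-assoc _ _ _) distribʳ--) (*-assoc _ _ _)) (trans (*-congˡ (+-congˡ (Fixed-* (q-central _) (Fixed-σ′ t fix)))) (distribˡ _ _ _)) ⟩
    ((p * (S a * u) - q * (S a * u)) + p * (q * u)) + (q * (S a * u) + q * (p * (q * r)))
                                                       ≈⟨ rearrange ⟩
    p * (S a * u) + (p * (q * u) + q * (p * (q * r)))  ≈⟨ +-congˡ (+-congˡ (commute-past (q-central _))) ⟩
    p * (S a * u) + (p * (q * u) + p * (q * (q * r)))  ≈⟨ +-congˡ (trans (*-congˡ (distribˡ _ _ _)) (distribˡ _ _ _)) ⟨
    p * (S a * u) + p * (q * (u + q * r))              ≈⟨ distribˡ _ _ _ ⟨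
    p * (S a * u + q * (u + q * r))                    ∎
    where
    u = up o t y
    r = σ o t y
    Fixed-σ′ : ∀ t → (∀ {a} → o < a → a < suc (o ℕ.+ t) → Fixed a y) → Fixed (o ℕ.+ t) (σ o t y)
    Fixed-σ′ zero    fix = trans (zeroʳ _) (sym (zeroʳ _))
    Fixed-σ′ (suc t) fix = Fixed-σ-above o (suc t) ℕ.≤-refl (fix (ℕ.m<m+n o ℕ.z<s) ℕ.≤-refl)
    rearrange : ∀ {e f g h} → ((e - f) + g) + (f + h) ≈ e + (g + h)
    rearrange {e} {f} {g} {h} = begin
      ((e - f) + g) + (f + h)   ≈⟨ interchange _ _ _ _ ⟩
      ((e - f) + f) + (g + h)   ≈⟨ +-congʳ (trans (+-assoc _ _ _) (trans (+-congˡ (-‿inverseˡ f)) (+-identityʳ e))) ⟩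
      e + (g + h)               ∎

-- Finite sums.

module Sums (A : Ring 0ℓ 0ℓ) where
  open RingOps A hiding (zero)
  private variable
    B B′ B″ : Set

  ∑-cong : {f g : B → Carrier} → (∀ e → f e ≈ g e) → ∀ es → ∑ (map f es) ≈ ∑ (map g es)
  ∑-cong eq []       = refl
  ∑-cong eq (e ∷ es) = +-cong (eq e) (∑-cong eq es)

  ∑-map : {f : B′ → Carrier} (g : B → B′) → ∀ es → ∑ (map f (map g es)) ≈ ∑ (map (f ∘ g) es)
  ∑-map g es = reflexive (cong ∑ (≡.sym (List.map-∘ es)))

  ∑-++ : ∀ xs {ys} → ∑ (xs ++ ys) ≈ ∑ xs + ∑ ys
  ∑-++ []       = sym (+-identityˡ _)
  ∑-++ (x ∷ xs) = trans (+-congˡ (∑-++ xs)) (sym (+-assoc _ _ _))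

  ∑-additive : (φ : Carrier → Carrier) → φ 0# ≈ 0# → (∀ y z → φ (y + z) ≈ φ y + φ z) →
               {f : B → Carrier} → ∀ es → φ (∑ (map f es)) ≈ ∑ (map (φ ∘ f) es)
  ∑-additive φ φ0 φ+ []       = φ0
  ∑-additive φ φ0 φ+ (e ∷ es) = trans (φ+ _ _) (+-congˡ (∑-additive φ φ0 φ+ es))

  *-∑ : ∀ c {f : B → Carrier} es → c * ∑ (map f es) ≈ ∑ (map (λ e → c * f e) es)
  *-∑ c = ∑-additive (c *_) (zeroʳ c) (distribˡ c)

  ∑-cartesianProductWith : (f : B″ → Carrier) (g : B → B′ → B″) → ∀ xs ys →
    ∑ (map f (cartesianProductWith g xs ys)) ≈ ∑ (map (λ x → ∑ (map (λ y → f (g x y)) ys)) xs)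
  ∑-cartesianProductWith f g []       ys = refl
  ∑-cartesianProductWith f g (x ∷ xs) ys = trans (reflexive (cong ∑ (List.map-++ f (map (g x) ys) _)))
    (trans (∑-++ (map f (map (g x) ys))) (+-cong (∑-map (g x) ys) (∑-cartesianProductWith f g xs ys)))

  ∑-↭ : {f : B → Carrier} {xs ys : List B} → xs ↭ ys → ∑ (map f xs) ≈ ∑ (map f ys)
  ∑-↭ ↭.refl          = refl
  ∑-↭ (↭.prep x eq)   = +-congˡ (∑-↭ eq)
  ∑-↭ (↭.swap x y eq) = trans (+-congˡ (+-congˡ (∑-↭ eq)))
    (trans (sym (+-assoc _ _ _)) (trans (+-congʳ (+-comm _ _)) (+-assoc _ _ _)))
  ∑-↭ (↭.trans eq eq′) = trans (∑-↭ eq) (∑-↭ eq′)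

  ∑-allFin : ∀ {n} (f : Fin (suc n) → Carrier) → ∑ (map f (allFin (suc n))) ≈ f zero + ∑ (map (f ∘ suc) (allFin n))
  ∑-allFin {n} f = +-congˡ (trans (reflexive (cong (∑ ∘ map f) (≡.sym (List.map-tabulate id suc)))) (∑-map suc (allFin n)))

-- Multiplication by one variable, row by row.

-- The 0-based index of the x-variable attached to row i.
depth : Fin k → ℕ
depth {suc k} zero    = k
depth {suc k} (suc i) = depth i

depth< : (i : Fin k) → depth i < k
depth< {suc k} zero    = ℕ.≤-refl
depth< {suc k} (suc i) = ℕ.m≤n⇒m≤1+n (depth< i)

module RowAction {A : Ring 0ℓ 0ℓ} {n : ℕ} (H : AffineHecke A n) where
  open RingOps A hiding (zero)
  open AffineHecke H
  open AffineHeckeProperties H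
  open Sums A
  open import Relation.Binary.Reasoning.Setoid setoid

  private variable
    c y z : Carrier

  -- For o = 0 this is left multiplication by T̄ of the Grassmannian
  -- permutation with the given rows.
  W : ℕ → Vec ℕ k → Carrier → Carrier
  W o []              y = y
  W o (_∷_ {k} a v) y = W o v (up (o ℕ.+ k) a y)

  W-cong : ∀ o (v : Vec ℕ k) → y ≈ z → W o v y ≈ W o v z
  W-cong o []      eq = eq
  W-cong o (a ∷ v) eq = W-cong o v (up-cong _ a eq)

  W-0 : ∀ o (v : Vec ℕ k) → W o v 0# ≈ 0#
  W-0 o []      = refl
  W-0 o (a ∷ v) = trans (W-cong o v (up-0 _ a)) (W-0 o v)

  W-+ : ∀ o (v : Vec ℕ k) → W o v (y + z) ≈ W o v y + W o v z
  W-+ o []      = refl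
  W-+ o (a ∷ v) = trans (W-cong o v (up-+ _ a)) (W-+ o v)

  W-central : ∀ o (v : Vec ℕ k) → (∀ y → c * y ≈ y * c) → W o v (c * y) ≈ c * W o v y
  W-central o []      central = refl
  W-central o (a ∷ v) central = trans (W-cong o v (up-central _ a central)) (W-central o v central)

  W-commute : {v : Vec ℕ k} → Fits m v → (∀ {a} → suc a < k ℕ.+ m → c * S a ≈ S a * c) → W 0 v (c * y) ≈ c * W 0 v y
  W-commute [] h = refl
  W-commute {k = suc k} {v = a ∷ v} (a≤m ∷ fit) h = trans
    (W-cong 0 v (up-commute k a λ _ lt → h (s≤s (ℕ.<-≤-trans lt (ℕ.+-monoʳ-≤ k a≤m)))))
    (W-commute fit λ lt → h (ℕ.m≤n⇒m≤1+n (ℕ.<-≤-trans lt (ℕ.+-monoʳ-≤ k a≤m))))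

  term : Carrier → Weighted k → Carrier
  term y (h , w , u) = p ^ h * (q ^ w * W 0 u y)

  -- The recursions agree. If the next row is shorter, the longest run in `σ` is the ribbon that
  -- ends at the head, and the remaining factor q is one more column. If it is equally long,
  -- `up-σ-fixed` moves `σ` one row down, and the factor p is one more row.
  headRibbons-sum : ∀ b (l : Vec ℕ k) → Fits b l → k ℕ.+ b < n → (∀ {a} → a < k → Fixed a y) →
                    ∑ (map (term y) (headRibbons b l)) ≈ W 0 l (σ k b y)
  headRibbons-sum zero    l fit lt fix = sym (W-0 0 l)
  headRibbons-sum (suc b) l fit lt fix with top l ℕ.≤? b
  headRibbons-sum {k} {y} (suc b) l fit lt fix | yes le = begin
    1# * (1# * W 0 l (up k b y)) + ∑ (map (term y) (map widen (headRibbons b l)))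
      ≈⟨ +-cong (trans (*-identityˡ _) (*-identityˡ _)) (trans (∑-map widen rs) (∑-cong widened rs)) ⟩
    W 0 l (up k b y) + ∑ (map (λ e → q * term y e) (headRibbons b l))
      ≈⟨ +-congˡ (*-∑ q rs) ⟨
    W 0 l (up k b y) + q * ∑ (map (term y) (headRibbons b l))
      ≈⟨ +-congˡ (*-congˡ (headRibbons-sum b l (Fits-rebound le fit) (ℕ.<-trans (ℕ.+-monoʳ-< k (ℕ.n<1+n b)) lt) fix)) ⟩
    W 0 l (up k b y) + q * W 0 l (σ k b y)
      ≈⟨ +-congˡ (W-central 0 l q-central) ⟨
    W 0 l (up k b y) + W 0 l (q * σ k b y)
      ≈⟨ W-+ 0 l ⟨
    W 0 l (up k b y + q * σ k b y) ∎
    where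
    rs = headRibbons b l
    widened : ∀ e → term y (widen e) ≈ q * term y e
    widened (h , w , u) = trans (*-congˡ (*-assoc _ _ _)) (sym (commute-past (q-central _)))
  headRibbons-sum (suc b) [] fit lt fix | no ¬le = contradiction z≤n ¬le
  headRibbons-sum {suc k} {y} (suc b) (c ∷ l) (c≤ ∷ fit) lt fix | no c≰b with ℕ.≤-antisym c≤ (ℕ.≰⇒> c≰b)
  ... | ≡.refl = begin
    ∑ (map (term y) (map (lower b) rs))          ≈⟨ trans (∑-map (lower b) rs) (∑-cong (λ _ → *-assoc _ _ _) rs) ⟩
    ∑ (map (λ e → p * term y′ e) rs)             ≈⟨ *-∑ p rs ⟨
    p * ∑ (map (term y′) rs)                     ≈⟨ *-congˡ (headRibbons-sum (suc b) l fit lt′ λ a<k → Fixed-up-below (suc k) b (s≤s a<k) (fix (ℕ.m≤n⇒m≤1+n a<k))) ⟩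
    p * W 0 l (σ k (suc b) y′)                   ≈⟨ W-central 0 l p-central ⟨
    W 0 l (p * σ k (suc b) y′)                   ≈⟨ W-cong 0 l (up-σ-fixed k b lt′ (fix ℕ.≤-refl)) ⟨
    W 0 l (up k (suc b) (σ (suc k) (suc b) y))   ∎
    where
    rs = headRibbons (suc b) l
    y′ = up (suc k) b y
    lt′ : k ℕ.+ suc b < n
    lt′ = ℕ.<-trans (ℕ.n<1+n _) lt

  -- Every row above row `i` lowers by one the indices at which the element is fixed
  -- (`Fixed-up-within`). So the equations assumed from `k` on become, when row `i` is reached,
  -- those above its starting index that `up-X` asks for.
  W-X : (i : Fin k) {v : Vec ℕ k} → Fits m v → k ℕ.+ m ≤ n →
        (∀ {a} → k ≤ a → suc a < k ℕ.+ m → Fixed a y) → (∀ {a} → a < depth i → Fixed a y) →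
        W 0 v (X (depth i) * y) ≈
          X (depth i ℕ.+ lookup v i) * W 0 v y + κ (depth i ℕ.+ lookup v i) * ∑ (map (term y) (ribbons i v))
  W-X {suc k} {m} {y} zero {b ∷ l} (b≤m ∷ fit) km≤n fix fix′ = begin
    W 0 l (up k b (X k * y))                                     ≈⟨ W-cong 0 l (up-X k b kb<n λ k<a a< → fix k<a (s≤s (ℕ.<-≤-trans a< (ℕ.+-monoʳ-≤ k b≤m)))) ⟩
    W 0 l (X (k ℕ.+ b) * up k b y + κ (k ℕ.+ b) * σ k b y)       ≈⟨ W-+ 0 l ⟩
    W 0 l (X (k ℕ.+ b) * up k b y) + W 0 l (κ (k ℕ.+ b) * σ k b y)
      ≈⟨ +-cong (W-commute fit λ lt → sym (S-X (ℕ.>⇒≢ (ℕ.<-trans (ℕ.n<1+n _) lt)) (ℕ.>⇒≢ lt)))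
                (W-commute fit λ lt → S-κ (ℕ.>⇒≢ (ℕ.<-trans (ℕ.n<1+n _) lt)) (ℕ.>⇒≢ lt)) ⟩
    X (k ℕ.+ b) * W 0 l (up k b y) + κ (k ℕ.+ b) * W 0 l (σ k b y)
      ≈⟨ +-congˡ (*-congˡ (headRibbons-sum b l fit kb<n fix′)) ⟨
    X (k ℕ.+ b) * W 0 l (up k b y) + κ (k ℕ.+ b) * ∑ (map (term y) (headRibbons b l)) ∎
    where
    kb<n : k ℕ.+ b < n
    kb<n = ℕ.<-≤-trans (s≤s (ℕ.+-monoʳ-≤ k b≤m)) km≤n
  W-X {suc k} {m} {y} (suc i) {a ∷ l} (a≤m ∷ fit) km≤n fix fix′ = begin
    W 0 l (up k a (X (depth i) * y))   ≈⟨ W-cong 0 l (up-X-below k a (depth< i)) ⟩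
    W 0 l (X (depth i) * up k a y)     ≈⟨ W-X i fit (ℕ.<⇒≤ ka<n)
      (λ k≤c lt → Fixed-up-within k a ka<n k≤c lt (fix (s≤s k≤c) (s≤s (ℕ.<-≤-trans lt (ℕ.+-monoʳ-≤ k a≤m)))))
      (λ lt → Fixed-up-below k a (ℕ.≤-<-trans lt (depth< i)) (fix′ lt)) ⟩
    _ + κ _ * ∑ (map (term (up k a y)) (ribbons i l))   ≈⟨ +-congˡ (*-congˡ (∑-map (prepend a) (ribbons i l))) ⟨
    _ ∎
    where
    ka<n : k ℕ.+ a < n
    ka<n = ℕ.<-≤-trans (s≤s (ℕ.+-monoʳ-≤ k a≤m)) km≤n

  -- The symmetriser of the parabolic subgroup on positions o, …, o + k - 1.
  E : ℕ → ℕ → Carrier → Carrier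
  E o zero    y = y
  E o (suc k) y = σ o (suc k) (E (suc o) k y)

  Fixed-E : ∀ o k → o ℕ.+ k ≤ n → o ≤ a → suc a < o ℕ.+ k → Fixed a (E o k y)
  Fixed-E {a} o zero le o≤a lt = contradiction (ℕ.<-trans (ℕ.n<1+n a) (≡.subst (suc a <_) (ℕ.+-identityʳ o) lt)) (ℕ.≤⇒≯ o≤a)
  Fixed-E {a} o (suc k) le o≤a lt = Fixed-σ-within o k (≡.subst (_≤ n) (ℕ.+-suc o k) le)
    (λ o<c c< → Fixed-E (suc o) k (≡.subst (_≤ n) (ℕ.+-suc o k) le) o<c (s≤s c<)) o≤a (ℕ.≤-pred (≡.subst (suc a <_) (ℕ.+-suc o k) lt))

  Fixed-E-above : ∀ o k → o ℕ.+ k ≤ a → Fixed a y → Fixed a (E o k y)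
  Fixed-E-above o zero    le fix = fix
  Fixed-E-above {a} o (suc k) le fix = Fixed-σ-above o (suc k) le (Fixed-E-above (suc o) k (≡.subst (_≤ a) (ℕ.+-suc o k) le) fix)

-- Lehmer codes and lengths.

-- The Lehmer code; word π is the product of the words descend j over its digits j.
code : ∀ {n} → Permutation′ n → List ℕ
code {zero}  π = []
code {suc n} π = toℕ (π ⟨$⟩ʳ zero) ∷ code (remove zero π)

length-code : ∀ {n} (π : Permutation′ n) → length (code π) ≡ n
length-code {zero}  π = ≡.refl
length-code {suc n} π = cong suc (length-code (remove zero π))

remove-≈ : ∀ {n} {π : Permutation′ (suc n)} {σ : Permutation′ n} →
           (∀ i → π ⟨$⟩ʳ suc i ≡ punchIn (π ⟨$⟩ʳ zero) (σ ⟨$⟩ʳ i)) → remove zero π ≈ₚ σ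
remove-≈ {π = π} h i = Fin.punchIn-injective (π ⟨$⟩ʳ zero) _ _ (≡.trans (≡.sym (punchIn-permute π zero i)) (h i))

code-cong : ∀ {n} {π ρ : Permutation′ n} → π ≈ₚ ρ → code π ≡ code ρ
code-cong {zero}  eq = ≡.refl
code-cong {suc n} {π} {ρ} eq = cong₂ _∷_ (cong toℕ (eq zero)) (code-cong (remove-≈ {π = π} {σ = remove zero ρ} λ i →
  ≡.trans (eq (suc i)) (≡.trans (punchIn-permute ρ zero i) (cong (λ j → punchIn j (remove zero ρ ⟨$⟩ʳ i)) (≡.sym (eq zero))))))

code-insert : ∀ {n} (j : Fin (suc n)) (π : Permutation′ n) → code (insert zero j π) ≡ toℕ j ∷ code π
code-insert j π = cong (toℕ j ∷_) (code-cong (remove-insert zero j π))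

private
  punchIn-↑ˡ : (j : Fin (suc k)) (i : Fin k) → punchIn (j ↑ˡ m) (i ↑ˡ m) ≡ punchIn j i ↑ˡ m
  punchIn-↑ˡ zero    i       = ≡.refl
  punchIn-↑ˡ (suc j) zero    = ≡.refl
  punchIn-↑ˡ (suc j) (suc i) = cong suc (punchIn-↑ˡ j i)

  punchIn-↑ʳ : ∀ k (j : Fin (suc k)) (i : Fin m) → punchIn (j ↑ˡ m) (k ↑ʳ i) ≡ suc k ↑ʳ i
  punchIn-↑ʳ k       zero    i = ≡.refl
  punchIn-↑ʳ (suc k) (suc j) i = cong suc (punchIn-↑ʳ k j i)

code-⊞ : (u : Permutation′ k) (v : Permutation′ m) → code (u ⊞ v) ≡ code u ++ code v
code-⊞ {zero}  u v = code-cong λ _ → ≡.refl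
code-⊞ {suc k} {m} u v = cong₂ _∷_ (Fin.toℕ-↑ˡ (u ⟨$⟩ʳ zero) m)
  (≡.trans (code-cong (remove-≈ {π = u ⊞ v} {σ = remove zero u ⊞ v} step)) (code-⊞ (remove zero u) v))
  where
  step : ∀ i → (u ⊞ v) ⟨$⟩ʳ suc i ≡ punchIn ((u ⟨$⟩ʳ zero) ↑ˡ m) ((remove zero u ⊞ v) ⟨$⟩ʳ i)
  step i with splitAt k i
  ... | inj₁ j = ≡.trans (cong (_↑ˡ m) (punchIn-permute u zero j)) (≡.sym (punchIn-↑ˡ (u ⟨$⟩ʳ zero) (remove zero u ⟨$⟩ʳ j)))
  ... | inj₂ j = ≡.sym (punchIn-↑ʳ k (u ⟨$⟩ʳ zero) (v ⟨$⟩ʳ j))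

length-word : ∀ {n} (π : Permutation′ n) → length (word π) ≡ sum (code π)
length-word {zero}  π = ≡.refl
length-word {suc n} π = ≡.trans (List.length-++ (descend (π ⟨$⟩ʳ zero)))
  (cong₂ ℕ._+_ (length-descend (π ⟨$⟩ʳ zero)) (≡.trans (List.length-map suc (word (remove zero π))) (length-word (remove zero π))))
  where
  length-descend : ∀ {n} (j : Fin (suc n)) → length (descend j) ≡ toℕ j
  length-descend zero = ≡.refl
  length-descend {suc n} (suc j) = ≡.trans (List.length-++ (map suc (descend j)))
    (≡.trans (ℕ.+-comm _ 1) (cong suc (≡.trans (List.length-map suc (descend j)) (length-descend j))))

suc-C-2 : ∀ n → suc n C 2 ≡ n ℕ.+ n C 2
suc-C-2 n = ≡.trans (≡.sym (nCk+nC[k+1]≡[n+1]C[k+1] n 1)) (cong (ℕ._+ n C 2) (nC1≡n n))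

-- Ensures that the truncated subtractions in the exponents of q never truncate and can be split by
-- `+-∸-+`.
sum-code : ∀ {n} (π : Permutation′ n) → sum (code π) ≤ n C 2
sum-code {zero}  π = z≤n
sum-code {suc n} π = ≡.subst (sum (code π) ≤_) (≡.sym (suc-C-2 n)) (ℕ.+-mono-≤ (ℕ.≤-pred (Fin.toℕ<n (π ⟨$⟩ʳ zero))) (sum-code (remove zero π)))

+-∸-+ : ∀ {a b c d} → c ≤ a → d ≤ b → (a ℕ.+ b) ∸ (c ℕ.+ d) ≡ (a ∸ c) ℕ.+ (b ∸ d)
+-∸-+ {a} {b} {c} {d} c≤a d≤b = begin
  (a ℕ.+ b) ∸ (c ℕ.+ d)   ≡⟨ ℕ.∸-+-assoc (a ℕ.+ b) c d ⟨
  (a ℕ.+ b) ∸ c ∸ d       ≡⟨ cong (_∸ d) (ℕ.+-∸-comm b c≤a) ⟩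
  ((a ∸ c) ℕ.+ b) ∸ d     ≡⟨ ℕ.+-∸-assoc (a ∸ c) d≤b ⟩
  (a ∸ c) ℕ.+ (b ∸ d)     ∎
  where open ≡.≡-Reasoning

-- Reduced words and the symmetriser as operators.

index : ∀ {n} → Simple n → ℕ
index i = toℕ (lo i)

module CodeAction {A : Ring 0ℓ 0ℓ} {n : ℕ} (H : AffineHecke A n) where
  open RingOps A hiding (zero)
  open AffineHecke H
  open AffineHeckeProperties H
  open RowAction H
  open Sums A
  open import Algebra.Properties.Semiring.Exp semiring using (^-homo-*)
  open import Relation.Binary.Reasoning.Setoid setoid

  private variable
    y z : Carrier

  spell : ∀ {l} → ℕ → Word l → Carrier → Carrier
  spell o []       y = y
  spell o (a ∷ as) y = S (o ℕ.+ index a) * spell o as y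

  spell-++ : ∀ {l} o (as : Word l) {bs} → spell o (as ++ bs) y ≡ spell o as (spell o bs y)
  spell-++ o []       = ≡.refl
  spell-++ o (a ∷ as) = cong (_ *_) (spell-++ o as)

  spell-suc : ∀ {l} o (as : Word l) → spell o (map suc as) y ≡ spell (suc o) as y
  spell-suc o []       = ≡.refl
  spell-suc o (a ∷ as) = cong₂ _*_ (cong S (ℕ.+-suc o (index a))) (spell-suc o as)

  spell-descend : ∀ {l} o (j : Fin (suc l)) → spell o (descend j) y ≈ up o (toℕ j) y
  spell-descend o zero = refl
  spell-descend {y} {suc l} o (suc j) = begin
    spell o (map suc (descend j) ++ zero ∷ []) y         ≡⟨ spell-++ o (map suc (descend j)) ⟩
    spell o (map suc (descend j)) (S (o ℕ.+ 0) * y)      ≡⟨ spell-suc o (descend j) ⟩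
    spell (suc o) (descend j) (S (o ℕ.+ 0) * y)          ≈⟨ spell-descend (suc o) j ⟩
    up (suc o) (toℕ j) (S (o ℕ.+ 0) * y)                 ≡⟨ cong (λ a → up (suc o) (toℕ j) (S a * y)) (ℕ.+-identityʳ o) ⟩
    up (suc o) (toℕ j) (S o * y)                         ≈⟨ up-shift o (toℕ j) ⟨
    up o (suc (toℕ j)) y                                 ∎

  run : ℕ → List ℕ → Carrier → Carrier
  run o []       y = y
  run o (c ∷ cs) y = up o c (run (suc o) cs y)

  run-cong : ∀ o cs → y ≈ z → run o cs y ≈ run o cs z
  run-cong o []       eq = eq
  run-cong o (c ∷ cs) eq = up-cong o c (run-cong (suc o) cs eq)

  run-++ : ∀ o cs {ds} → run o (cs ++ ds) y ≡ run o cs (run (o ℕ.+ length cs) ds y)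
  run-++ o []       {ds} = cong (λ a → run a ds _) (≡.sym (ℕ.+-identityʳ o))
  run-++ {y} o (c ∷ cs) {ds} = cong (up o c) (≡.trans (run-++ (suc o) cs) (cong (λ a → run (suc o) cs (run a ds y)) (≡.sym (ℕ.+-suc o (length cs)))))

  run-0 : ∀ o cs → run o cs 0# ≈ 0#
  run-0 o []       = refl
  run-0 o (c ∷ cs) = trans (up-cong o c (run-0 (suc o) cs)) (up-0 o c)

  run-+ : ∀ o cs y z → run o cs (y + z) ≈ run o cs y + run o cs z
  run-+ o []       y z = refl
  run-+ o (c ∷ cs) y z = trans (up-cong o c (run-+ (suc o) cs y z)) (up-+ o c)

  run-central : ∀ o cs {c} → (∀ y → c * y ≈ y * c) → run o cs (c * y) ≈ c * run o cs y
  run-central o []       central = refl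
  run-central o (c ∷ cs) central = trans (up-cong o c (run-central (suc o) cs central)) (up-central o c central)

  spell-word : ∀ {l} o (π : Permutation′ l) → spell o (word π) y ≈ run o (code π) y
  spell-word {l = zero}  o π = refl
  spell-word {y} {suc l} o π = begin
    spell o (descend j ++ map suc (word (remove zero π))) y         ≡⟨ spell-++ o (descend j) ⟩
    spell o (descend j) (spell o (map suc (word (remove zero π))) y) ≈⟨ spell-descend o j ⟩
    up o (toℕ j) (spell o (map suc (word (remove zero π))) y)       ≈⟨ up-cong o (toℕ j) (trans (reflexive (spell-suc o (word (remove zero π)))) (spell-word (suc o) (remove zero π))) ⟩
    up o (toℕ j) (run (suc o) (code (remove zero π)) y)             ∎
    where j = π ⟨$⟩ʳ zero

  run-id : ∀ l o → run o (code (idₚ {l})) y ≈ y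
  run-id zero    o = refl
  run-id {y} (suc l) o = trans (reflexive (cong (λ cs → run (suc o) cs y) (code-cong {l} {π = remove zero idₚ} {ρ = idₚ} λ _ → ≡.refl))) (run-id l (suc o))

  -- `W` peels off the first row, which acts innermost, while `w` is built by inserting the last
  -- row, which acts outermost; this reads `W` from the other end.
  W-dropLastRow : ∀ o (ν : Partition (suc k) m) →
                  W o (rows ν) y ≡ up o (row ν (fromℕ k)) (W (suc o) (rows (dropLastRow ν)) y)
  W-dropLastRow {k = zero}  {y = y} o (a ∷ []) = cong (λ j → up j (toℕ a) y) (ℕ.+-identityʳ o)
  W-dropLastRow {k = suc k} {y = y} o (a ∷ ν) = ≡.trans (W-dropLastRow o ν)
    (cong (λ j → up o (row ν (fromℕ k)) (W (suc o) (rows (dropLastRow ν)) (up j (toℕ a) y))) (ℕ.+-suc o k))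

  run-w : ∀ o (ν : Partition k m) → run o (code (w ν)) y ≈ W o (rows ν) y
  run-w {zero}  {m} o [] = run-id m o
  run-w {suc k} {m} {y} o ν = begin
    run o (code (w ν)) y                                       ≡⟨ cong (λ cs → run o cs y) (code-insert (w ν ⟨$⟩ʳ zero) (w (dropLastRow ν))) ⟩
    up o (toℕ (w ν ⟨$⟩ʳ zero)) (run (suc o) (code (w (dropLastRow ν))) y)
      ≈⟨ trans (reflexive (cong (λ c → up o c (run (suc o) (code (w (dropLastRow ν))) y)) w-first)) (up-cong o (row ν (fromℕ k)) (run-w (suc o) (dropLastRow ν))) ⟩
    up o (row ν (fromℕ k)) (W (suc o) (rows (dropLastRow ν)) y) ≡⟨ W-dropLastRow o ν ⟨
    W o (rows ν) y                                             ∎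
    where
    w-first : toℕ (w ν ⟨$⟩ʳ zero) ≡ row ν (fromℕ k)
    w-first = Fin.toℕ-fromℕ< _

  ^-central : ∀ {c} → (∀ y → c * y ≈ y * c) → ∀ e y → c ^ e * y ≈ y * c ^ e
  ^-central central zero    y = trans (*-identityˡ y) (sym (*-identityʳ y))
  ^-central central (suc e) y = commute-* (central y) (^-central central e y)

  -- `σ` grows by its longest run, but `allFin` starts with the smallest entry, so the empty run has
  -- to be split off.
  σ-shift : ∀ o b → σ o (suc b) z ≈ q ^ b * z + σ (suc o) b (S o * z)
  σ-shift o zero = +-cong (sym (*-identityˡ _)) (zeroʳ q)
  σ-shift {z} o (suc b) = begin
    up o (suc b) z + q * σ o (suc b) z                                  ≈⟨ +-cong (up-shift o b) (*-congˡ (σ-shift o b)) ⟩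
    up (suc o) b z′ + q * (q ^ b * z + σ (suc o) b z′)                  ≈⟨ +-congˡ (trans (distribˡ _ _ _) (+-congʳ (sym (*-assoc _ _ _)))) ⟩
    up (suc o) b z′ + (q ^ suc b * z + q * σ (suc o) b z′)              ≈⟨ trans (sym (+-assoc _ _ _)) (trans (+-congʳ (+-comm _ _)) (+-assoc _ _ _)) ⟩
    q ^ suc b * z + (up (suc o) b z′ + q * σ (suc o) b z′)              ∎
    where z′ = S o * z

  ∑-up : ∀ o b → ∑ (map (λ j → q ^ (b ∸ toℕ j) * up o (toℕ j) z) (allFin (suc b))) ≈ σ o (suc b) z
  ∑-up o zero = +-cong (*-identityˡ _) (sym (zeroʳ q))
  ∑-up {z} o (suc b) = begin
    ∑ (map (λ j → q ^ (suc b ∸ toℕ j) * up o (toℕ j) z) (allFin (suc (suc b))))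
      ≈⟨ ∑-allFin {suc b} (λ j → q ^ (suc b ∸ toℕ j) * up o (toℕ j) z) ⟩
    q ^ suc b * z + ∑ (map (λ j → q ^ (b ∸ toℕ j) * up o (suc (toℕ j)) z) (allFin (suc b)))
      ≈⟨ +-congˡ (∑-cong (λ j → *-congˡ (up-shift o (toℕ j))) (allFin (suc b))) ⟩
    q ^ suc b * z + ∑ (map (λ j → q ^ (b ∸ toℕ j) * up (suc o) (toℕ j) (S o * z)) (allFin (suc b)))
      ≈⟨ +-congˡ (∑-up (suc o) b) ⟩
    q ^ suc b * z + σ (suc o) (suc b) (S o * z)
      ≈⟨ σ-shift o (suc b) ⟨
    σ o (suc (suc b)) z ∎

  -- An operator version of the factorisation of the inversion generating function. Since C(l+1, 2)
  -- = l + C(l, 2), a first digit j takes the exponent l - j and leaves the right weight for the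
  -- other digits, so the sum factors digit by digit.
  ∑-permutations : ∀ o l → ∑ (map (λ π → q ^ (l C 2 ∸ sum (code π)) * run o (code π) y) (permutations l)) ≈ E o l y
  ∑-permutations o zero = trans (+-identityʳ _) (*-identityˡ _)
  ∑-permutations {y} o (suc l) = begin
    ∑ (map (summand o (suc l)) (permutations (suc l)))
      ≈⟨ ∑-cartesianProductWith (summand o (suc l)) (insert zero) (allFin (suc l)) (permutations l) ⟩
    ∑ (map (λ j → ∑ (map (λ π → summand o (suc l) (insert zero j π)) (permutations l))) (allFin (suc l)))
      ≈⟨ ∑-cong (λ j → trans (∑-cong (λ π → split j π) (permutations l)) (sym (collect j))) (allFin (suc l)) ⟩
    ∑ (map (λ j → q ^ (l ∸ toℕ j) * up o (toℕ j) (∑ (map (summand (suc o) l) (permutations l)))) (allFin (suc l)))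
      ≈⟨ ∑-up o l ⟩
    σ o (suc l) (∑ (map (summand (suc o) l) (permutations l)))
      ≈⟨ σ-cong o (suc l) (∑-permutations (suc o) l) ⟩
    σ o (suc l) (E (suc o) l y) ∎
    where
    summand : ∀ o l → Permutation′ l → Carrier
    summand o l π = q ^ (l C 2 ∸ sum (code π)) * run o (code π) y

    split : ∀ j π → summand o (suc l) (insert zero j π) ≈ q ^ (l ∸ toℕ j) * up o (toℕ j) (summand (suc o) l π)
    split j π = begin
      summand o (suc l) (insert zero j π)
        ≡⟨ cong (λ cs → q ^ (suc l C 2 ∸ sum cs) * run o cs y) (code-insert j π) ⟩
      q ^ (suc l C 2 ∸ (toℕ j ℕ.+ sum (code π))) * up o (toℕ j) r
        ≡⟨ cong (λ e → q ^ e * up o (toℕ j) r) (≡.trans (cong (_∸ (toℕ j ℕ.+ sum (code π))) (suc-C-2 l)) (+-∸-+ (ℕ.≤-pred (Fin.toℕ<n j)) (sum-code π))) ⟩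
      q ^ ((l ∸ toℕ j) ℕ.+ e′) * up o (toℕ j) r
        ≈⟨ trans (*-congʳ (^-homo-* q (l ∸ toℕ j) e′)) (*-assoc _ _ _) ⟩
      q ^ (l ∸ toℕ j) * (q ^ e′ * up o (toℕ j) r)
        ≈⟨ *-congˡ (up-central o (toℕ j) (^-central q-central e′)) ⟨
      q ^ (l ∸ toℕ j) * up o (toℕ j) (q ^ e′ * r) ∎
      where
      r = run (suc o) (code π) y
      e′ = l C 2 ∸ sum (code π)

    collect : ∀ j → q ^ (l ∸ toℕ j) * up o (toℕ j) (∑ (map (summand (suc o) l) (permutations l))) ≈
              ∑ (map (λ π → q ^ (l ∸ toℕ j) * up o (toℕ j) (summand (suc o) l π)) (permutations l))
    collect j = trans (*-congˡ (∑-additive (up o (toℕ j)) (up-0 o (toℕ j)) (λ _ _ → up-+ o (toℕ j)) (permutations l)))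
      (*-∑ _ (permutations l))

  ∑-permutations-⊞ : ∀ k m →
    ∑ (cartesianProductWith (λ u v → q ^ (k C 2 ℕ.+ m C 2 ∸ sum (code (u ⊞ v))) * run 0 (code (u ⊞ v)) y) (permutations k) (permutations m))
      ≈ E 0 k (E k m y)
  ∑-permutations-⊞ {y} k m = begin
    ∑ (cartesianProductWith f (permutations k) (permutations m))
      ≡⟨ cong ∑ (List.map-id (cartesianProductWith f (permutations k) (permutations m))) ⟨
    ∑ (map id (cartesianProductWith f (permutations k) (permutations m)))
      ≈⟨ ∑-cartesianProductWith id f (permutations k) (permutations m) ⟩
    ∑ (map (λ u → ∑ (map (f u) (permutations m))) (permutations k))
      ≈⟨ ∑-cong (λ u → trans (∑-cong (split u) (permutations m)) (sym (collect u))) (permutations k) ⟩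
    ∑ (map (λ u → q ^ (k C 2 ∸ sum (code u)) * run 0 (code u) (∑ (map g (permutations m)))) (permutations k))
      ≈⟨ ∑-cong (λ u → *-congˡ (run-cong 0 (code u) (∑-permutations k m))) (permutations k) ⟩
    ∑ (map (λ u → q ^ (k C 2 ∸ sum (code u)) * run 0 (code u) (E k m y)) (permutations k))
      ≈⟨ ∑-permutations 0 k ⟩
    E 0 k (E k m y) ∎
    where
    f : Permutation′ k → Permutation′ m → Carrier
    f u v = q ^ (k C 2 ℕ.+ m C 2 ∸ sum (code (u ⊞ v))) * run 0 (code (u ⊞ v)) y
    g : Permutation′ m → Carrier
    g v = q ^ (m C 2 ∸ sum (code v)) * run k (code v) y

    split : ∀ u v → f u v ≈ q ^ (k C 2 ∸ sum (code u)) * run 0 (code u) (g v)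
    split u v = begin
      f u v
        ≡⟨ cong (λ cs → q ^ (k C 2 ℕ.+ m C 2 ∸ sum cs) * run 0 cs y) (code-⊞ u v) ⟩
      q ^ (k C 2 ℕ.+ m C 2 ∸ sum (code u ++ code v)) * run 0 (code u ++ code v) y
        ≡⟨ cong₂ (λ e z → q ^ e * z)
            (≡.trans (cong (k C 2 ℕ.+ m C 2 ∸_) (sum-++ (code u) (code v))) (+-∸-+ (sum-code u) (sum-code v)))
            (≡.trans (run-++ 0 (code u)) (cong (λ a → run 0 (code u) (run a (code v) y)) (length-code u))) ⟩
      q ^ ((k C 2 ∸ sum (code u)) ℕ.+ e′) * run 0 (code u) (run k (code v) y)
        ≈⟨ trans (*-congʳ (^-homo-* q (k C 2 ∸ sum (code u)) e′)) (*-assoc _ _ _) ⟩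
      q ^ (k C 2 ∸ sum (code u)) * (q ^ e′ * run 0 (code u) (run k (code v) y))
        ≈⟨ *-congˡ (run-central 0 (code u) (^-central q-central e′)) ⟨
      q ^ (k C 2 ∸ sum (code u)) * run 0 (code u) (g v) ∎
      where e′ = m C 2 ∸ sum (code v)

    collect : ∀ u → q ^ (k C 2 ∸ sum (code u)) * run 0 (code u) (∑ (map g (permutations m))) ≈
              ∑ (map (λ v → q ^ (k C 2 ∸ sum (code u)) * run 0 (code u) (g v)) (permutations m))
    collect u = trans (*-congˡ (∑-additive (run 0 (code u)) (run-0 0 (code u)) (run-+ 0 (code u)) (permutations m)))
      (*-∑ _ (permutations m))

-- The presented algebra in terms of the shifted generators.

simple : ∀ n a → (∃ λ (i : Simple n) → index i ≡ a) ⊎ n ≤ suc a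
simple zero          a       = inj₂ z≤n
simple (suc zero)    a       = inj₂ (s≤s z≤n)
simple (suc (suc n)) zero    = inj₁ (zero , ≡.refl)
simple (suc (suc n)) (suc a) with simple (suc n) a
... | inj₁ (i , eq) = inj₁ (suc i , cong suc eq)
... | inj₂ le       = inj₂ (s≤s le)

toℕ-hi : ∀ {n} (i : Simple n) → toℕ (hi i) ≡ suc (index i)
toℕ-hi zero    = ≡.refl
toℕ-hi (suc i) = cong suc (toℕ-hi i)

index-injective : ∀ {n} (i j : Simple n) → index i ≡ index j → i ≡ j
index-injective zero    zero    eq = ≡.refl
index-injective (suc i) (suc j) eq = cong suc (index-injective i j (ℕ.suc-injective eq))

module Shift (A : Ring 0ℓ 0ℓ) {e : Ring.Carrier A} (e-central : ∀ y → Ring._≈_ A (Ring._*_ A e y) (Ring._*_ A y e)) where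
  open Ring A
  open import Relation.Binary.Reasoning.Setoid setoid

  private variable
    t u r y : Carrier

  commute-shift : t * y ≈ y * t → (t + e) * y ≈ y * (t + e)
  commute-shift ty = trans (distribʳ _ _ _) (trans (+-cong ty (e-central _)) (sym (distribˡ _ _ _)))

  -- Modulo the braid relation for t and u, the two sides differ by e (t (t + e) - u (u + e)), and
  -- both quadratic expressions equal r.
  braid-shift : t * u * t ≈ u * t * u → (t + e) * t ≈ r → u * (u + e) ≈ r →
                (t + e) * ((u + e) * (t + e)) ≈ (u + e) * ((t + e) * (u + e))
  braid-shift {t} {u} {r} tut tt uu = begin
    t′ * (u′ * t′)                    ≈⟨ trans (*-congˡ (distribˡ _ _ _)) (distribˡ _ _ _) ⟩
    t′ * (u′ * t) + t′ * (u′ * e)     ≈⟨ +-cong half (trans (sym (*-assoc _ _ _)) (sym (e-central _))) ⟩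
    u * (t′ * u′) + e * (t′ * u′)     ≈⟨ distribʳ _ _ _ ⟨
    u′ * (t′ * u′)                    ∎
    where
    t′ = t + e
    u′ = u + e
    slide : t′ * (u * t) ≈ u * (t * u′)
    slide = begin
      t′ * (u * t)                  ≈⟨ distribʳ _ _ _ ⟩
      t * (u * t) + e * (u * t)     ≈⟨ +-cong (trans (sym (*-assoc _ _ _)) tut) (e-central _) ⟩
      u * t * u + u * t * e         ≈⟨ distribˡ _ _ _ ⟨
      u * t * u′                    ≈⟨ *-assoc _ _ _ ⟩
      u * (t * u′)                  ∎
    half : t′ * (u′ * t) ≈ u * (t′ * u′)
    half = begin
      t′ * (u′ * t)                 ≈⟨ trans (*-congˡ (distribʳ _ _ _)) (distribˡ _ _ _) ⟩
      t′ * (u * t) + t′ * (e * t)   ≈⟨ +-cong slide (trans (sym (*-assoc _ _ _)) (trans (*-congʳ (sym (e-central _))) (*-assoc _ _ _))) ⟩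
      u * (t * u′) + e * (t′ * t)   ≈⟨ +-congˡ (*-congˡ (trans tt (sym uu))) ⟩
      u * (t * u′) + e * (u * u′)   ≈⟨ +-congˡ (trans (sym (*-assoc _ _ _)) (trans (*-congʳ (e-central _)) (*-assoc _ _ _))) ⟩
      u * (t * u′) + u * (e * u′)   ≈⟨ trans (*-congˡ (distribʳ _ _ _)) (distribˡ _ _ _) ⟨
      u * (t′ * u′)                 ∎

module GrassmannianHecke (k m : ℕ) where
  open Grassmannian k m hiding (zero)
  open Sums H.Ĥ
  open import Algebra.Properties.Ring H.Ĥ using (-‿distribˡ-*; -‿distribʳ-*; x∙y⁻¹≈ε⇒x≈y)
  open import Relation.Binary.Reasoning.Setoid setoid

  private
    n : ℕ
    n = k ℕ.+ m

    p′ q′ ħ′ e : Carrier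
    p′ = H.con (ι A.p)
    q′ = H.con (ι A.q)
    ħ′ = H.con (ι A.ħ)
    e = p′ - q′

    e-central : ∀ y → e * y ≈ y * e
    e-central y = begin
      (p′ - q′) * y       ≈⟨ distribʳ _ _ _ ⟩
      p′ * y + - q′ * y   ≈⟨ +-cong (H.con-central _ y) (trans (sym (-‿distribˡ-* _ _)) (trans (-‿cong (H.con-central _ y)) (-‿distribʳ-* _ _))) ⟩
      y * p′ + y * - q′   ≈⟨ distribˡ _ _ _ ⟨
      y * (p′ - q′)       ∎

    open Shift H.Ĥ e-central

    T̄≈ : ∀ i → H.T̄ i ≈ H.T i + e
    T̄≈ i = +-assoc _ _ _

    T-T̄ : ∀ i → H.T i * (H.T i + e) ≈ p′ * q′
    T-T̄ i = x∙y⁻¹≈ε⇒x≈y _ _ (begin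
      t * (t + (p′ - q′)) - p′ * q′                  ≈⟨ +-congʳ (trans (distribˡ _ _ _) (+-congˡ (distribˡ _ _ _))) ⟩
      (t * t + (t * p′ + t * - q′)) - p′ * q′        ≈⟨ +-congʳ (+-congˡ (+-comm _ _)) ⟩
      (t * t + (t * - q′ + t * p′)) - p′ * q′        ≈⟨ +-congʳ (+-assoc _ _ _) ⟨
      ((t * t + t * - q′) + t * p′) - p′ * q′        ≈⟨ +-assoc _ _ _ ⟩
      (t * t + t * - q′) + (t * p′ - p′ * q′)        ≈⟨ +-cong (sym (distribˡ _ _ _)) (+-cong (sym (H.con-central _ t)) (-‿distribʳ-* _ _)) ⟩
      t * (t - q′) + (p′ * t + p′ * - q′)            ≈⟨ +-congˡ (distribˡ _ _ _) ⟨
      t * (t - q′) + p′ * (t - q′)                  ≈⟨ distribʳ _ _ _ ⟨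
      (t + p′) * (t - q′)                          ≈⟨ H.relation (H.quadratic i) ⟩
      0#                                         ∎)
      where t = H.T i

    -- Out of range the generators become 1 and the variables 0. Both are central, so `far` and
    -- `S-X` hold without bounds.
    sAt : ∀ {a} → (∃ λ (i : Simple n) → index i ≡ a) ⊎ n ≤ suc a → Carrier
    sAt (inj₁ (i , _)) = H.T i + e
    sAt (inj₂ _)       = 1#

    xAt : ∀ {b} → Dec (b < n) → Carrier
    xAt (yes lt) = x (fromℕ< lt)
    xAt (no _)   = 0#

    S X : ℕ → Carrier
    S a = sAt (simple n a)
    X b = xAt (b ℕ.<? n)

    S-index : ∀ i → S (index i) ≈ H.T i + e
    S-index i with simple n (index i)
    ... | inj₁ (j , eq) = reflexive (cong (λ j → H.T j + e) (index-injective j i eq))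
    ... | inj₂ le       = contradiction (≡.subst (_< n) (toℕ-hi i) (Fin.toℕ<n (hi i))) (ℕ.≤⇒≯ le)

    X-toℕ : ∀ j → X (toℕ j) ≈ x j
    X-toℕ j with toℕ j ℕ.<? n
    ... | yes lt = reflexive (cong x (Fin.fromℕ<-toℕ j lt))
    ... | no ¬lt = contradiction (Fin.toℕ<n j) ¬lt

    1-commutes : ∀ y → 1# * y ≈ y * 1#
    1-commutes y = trans (*-identityˡ y) (sym (*-identityʳ y))

    find : ∀ {a} → suc a < n → ∃ λ (i : Simple n) → index i ≡ a
    find {a} lt with simple n a
    ... | inj₁ found = found
    ... | inj₂ le    = contradiction lt (ℕ.≤⇒≯ le)

    quadratic : ∀ {a} → suc a < n → S a * S a ≈ e * S a + p′ * q′
    quadratic lt with find lt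
    ... | i , ≡.refl = begin
      S (index i) * S (index i)                        ≈⟨ *-cong (S-index i) (S-index i) ⟩
      (H.T i + e) * (H.T i + e)                        ≈⟨ distribʳ _ _ _ ⟩
      H.T i * (H.T i + e) + e * (H.T i + e)            ≈⟨ +-congʳ (T-T̄ i) ⟩
      p′ * q′ + e * (H.T i + e)                          ≈⟨ +-comm _ _ ⟩
      e * (H.T i + e) + p′ * q′                          ≈⟨ +-congʳ (*-congˡ (S-index i)) ⟨
      e * S (index i) + p′ * q′                          ∎

    braid : ∀ {a} → suc (suc a) < n → S a * (S (suc a) * S a) ≈ S (suc a) * (S a * S (suc a))
    braid {a} lt with find (ℕ.<-trans (ℕ.n<1+n (suc a)) lt) | find lt
    ... | i , ≡.refl | j , eq = begin
      S (index i) * (S (suc (index i)) * S (index i))            ≈⟨ *-cong (S-index i) (*-cong Sj (S-index i)) ⟩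
      (H.T i + e) * ((H.T j + e) * (H.T i + e))
        ≈⟨ braid-shift (H.relation (H.braid i j (Fin.toℕ-injective (≡.trans eq (≡.sym (toℕ-hi i))))))
             (trans (commute-shift refl) (T-T̄ i)) (T-T̄ j) ⟩
      (H.T j + e) * ((H.T i + e) * (H.T j + e))                  ≈⟨ *-cong Sj (*-cong (S-index i) Sj) ⟨
      S (suc (index i)) * (S (index i) * S (suc (index i)))      ∎
      where
      Sj : S (suc (index i)) ≈ H.T j + e
      Sj = trans (reflexive (cong S (≡.sym eq))) (S-index j)

    far : ∀ {a b} → suc a < b → S a * S b ≈ S b * S a
    far {a} {b} lt with simple n a | simple n b
    ... | inj₂ _ | _      = 1-commutes _
    ... | inj₁ _ | inj₂ _ = sym (1-commutes _)
    ... | inj₁ (i , ≡.refl) | inj₁ (j , ≡.refl) = commute-shift (sym (commute-shift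
      (sym (H.relation (H.far i j (≡.subst (_< index j) (≡.sym (toℕ-hi i)) lt))))))

    S-X : ∀ {a b} → b ≢ a → b ≢ suc a → S a * X b ≈ X b * S a
    S-X {a} {b} b≢a b≢sa with simple n a | b ℕ.<? n
    ... | inj₂ _ | _    = 1-commutes _
    ... | inj₁ _ | no _ = trans (zeroʳ _) (sym (zeroˡ _))
    ... | inj₁ (i , ≡.refl) | yes lt = commute-shift (H.relation (H.T-x i (fromℕ< lt)
      (λ eq → b≢a (≡.trans (≡.sym (Fin.toℕ-fromℕ< lt)) (cong toℕ eq)))
      (λ eq → b≢sa (≡.trans (≡.sym (Fin.toℕ-fromℕ< lt)) (≡.trans (cong toℕ eq) (toℕ-hi i))))))

    -- Both sides equal `x (hi i) * H.T i + ħ′`: the shift by e cancels the e-multiple of `x (lo i)`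
    -- on the left and that of `x (hi i)` on the right.
    S-X-lo : ∀ {a} → suc a < n → S a * X a ≈ X (suc a) * S a + (ħ′ - e * X (suc a))
    S-X-lo lt with find lt
    ... | i , ≡.refl = begin
      S (index i) * X (index i)                                  ≈⟨ *-cong (S-index i) (X-toℕ (lo i)) ⟩
      (H.T i + e) * x (lo i)                                     ≈⟨ distribʳ _ _ _ ⟩
      H.T i * x (lo i) + e * x (lo i)                            ≈⟨ +-congʳ (H.relation (H.T-x-lo i)) ⟩
      (x (hi i) * H.T i + (ħ′ - e * x (lo i))) + e * x (lo i)     ≈⟨ trans (+-assoc _ _ _) (+-congˡ (cancel _ _)) ⟩
      x (hi i) * H.T i + ħ′                                       ≈⟨ +-congˡ (trans (+-comm _ _) (cancel _ _)) ⟨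
      x (hi i) * H.T i + (e * x (hi i) + (ħ′ - e * x (hi i)))     ≈⟨ +-assoc _ _ _ ⟨
      (x (hi i) * H.T i + e * x (hi i)) + (ħ′ - e * x (hi i))     ≈⟨ +-congʳ (trans (distribˡ _ _ _) (+-congˡ (sym (e-central _)))) ⟨
      x (hi i) * (H.T i + e) + (ħ′ - e * x (hi i))                ≈⟨ +-cong (*-cong Xhi (S-index i)) (+-congˡ (-‿cong (*-congˡ Xhi))) ⟨
      X (suc (index i)) * S (index i) + (ħ′ - e * X (suc (index i))) ∎
      where
      cancel : ∀ y z → (y - z) + z ≈ y
      cancel y z = trans (+-assoc _ _ _) (trans (+-congˡ (-‿inverseˡ z)) (+-identityʳ y))
      Xhi : X (suc (index i)) ≈ x (hi i)
      Xhi = trans (reflexive (cong X (≡.sym (toℕ-hi i)))) (X-toℕ (hi i))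

  affineHecke : AffineHecke H.Ĥ n
  affineHecke = record
    { p = p′ ; q = q′ ; ħ = ħ′ ; S = S ; X = X
    ; p-central = H.con-central _ ; q-central = H.con-central _ ; ħ-central = H.con-central _
    ; quadratic = quadratic ; braid = braid ; far = far ; S-X = S-X ; S-X-lo = S-X-lo
    }

  open AffineHeckeProperties affineHecke
  open RowAction affineHecke
  open CodeAction affineHecke

  T̄-run : ∀ π y → T̄ π * y ≈ run 0 (code π) y
  T̄-run π y = trans (∏-spell (word π)) (spell-word 0 π)
    where
    ∏-spell : ∀ as → ∏ (map H.T̄ as) * y ≈ spell 0 as y
    ∏-spell []       = *-identityˡ y
    ∏-spell (a ∷ as) = trans (*-assoc _ _ _) (*-cong (trans (T̄≈ a) (sym (S-index a))) (∏-spell as))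

  T̄-w : ∀ (ν : Partition k m) y → T̄ (w ν) * y ≈ W 0 (rows ν) y
  T̄-w ν y = trans (T̄-run (w ν) y) (run-w 0 ν)

  con-^ : ∀ a l → H.con (ι (a A.^ l)) ≈ H.con (ι a) ^ l
  con-^ a zero    = refl
  con-^ a (suc l) = trans (H.con-cong (𝒜ħ[1/].con-* _ _)) (trans (H.con-* _ _) (*-congˡ (con-^ a l)))

  Σⁿₖ-E : Σⁿₖ ≈ H.con 𝒜ħ[1/].1/s * E 0 k (E k m 1#)
  Σⁿₖ-E = *-congˡ (trans (cong-cartesian summand≈ (permutations k) (permutations m)) (∑-permutations-⊞ k m))
    where
    summand≈ : ∀ u v → H.con (ι (A.q A.^ (d ∸ ℓ (u ⊞ v)))) * T̄ (u ⊞ v) ≈ q′ ^ (d ∸ sum (code (u ⊞ v))) * run 0 (code (u ⊞ v)) 1#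
    summand≈ u v = *-cong
      (trans (con-^ A.q (d ∸ ℓ (u ⊞ v))) (reflexive (cong (λ l → q′ ^ (d ∸ l)) (length-word (u ⊞ v)))))
      (trans (sym (*-identityʳ _)) (T̄-run (u ⊞ v) 1#))
    cong-cartesian : ∀ {f g : Permutation′ k → Permutation′ m → Carrier} → (∀ u v → f u v ≈ g u v) → ∀ us vs →
                     ∑ (cartesianProductWith f us vs) ≈ ∑ (cartesianProductWith g us vs)
    cong-cartesian eq []       vs = refl
    cong-cartesian eq (u ∷ us) vs = trans (∑-++ (map _ vs)) (trans (+-cong (∑-cong (eq u) vs) (cong-cartesian eq us vs)) (sym (∑-++ (map _ vs))))

  Fixed-Σ-left : ∀ {a} → suc a < k → Fixed a Σⁿₖ
  Fixed-Σ-left lt = Fixed-resp (sym Σⁿₖ-E) (Fixed-* (H.con-central _ _) (Fixed-E 0 k (ℕ.m≤m+n k m) z≤n lt))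

  Fixed-Σ-right : ∀ {a} → k ≤ a → suc a < n → Fixed a Σⁿₖ
  Fixed-Σ-right k≤a lt = Fixed-resp (sym Σⁿₖ-E) (Fixed-* (H.con-central _ _) (Fixed-E-above 0 k k≤a (Fixed-E k m ℕ.≤-refl k≤a lt)))

  -- The operators D and the induction on the number of variables.

  -- A version of `value` with Σ replaced by `z`, because during the induction the variables still
  -- to be moved stand between T̄ and Σ.
  valueAt : Carrier → Combination → Carrier
  valueAt z c = ∑ (map (λ (g , ν) → ⟦ g ⟧ * (T̄ (w ν) * z)) c)

  depth-opposite : ∀ {l} (i : Fin l) → depth i ≡ toℕ (opposite i)
  depth-opposite {suc l} zero    = ≡.sym (Fin.toℕ-fromℕ l)
  depth-opposite {suc l} (suc i) = ≡.trans (depth-opposite i) (≡.sym (Fin.toℕ-inject₁ (opposite i)))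

  position-depth : ∀ (μ : Partition k m) j → toℕ (position μ j) ≡ depth j ℕ.+ lookup (rows μ) j
  position-depth μ j = ≡.trans (Fin.toℕ-fromℕ< _) (≡.trans (ℕ.+-comm (row μ j) _)
    (≡.sym (cong₂ ℕ._+_ (depth-opposite j) (lookup-rows μ j))))

  open RingOps (CommutativeRing.ring (polynomialRing 𝒜ħ (Fin n))) using () renaming (_^_ to _↑_)

  ⟦con-^⟧ : ∀ a l → ⟦ P.con a ↑ l ⟧ ≈ H.con (ι a) ^ l
  ⟦con-^⟧ a zero    = refl
  ⟦con-^⟧ a (suc l) = *-congˡ (⟦con-^⟧ a l)

  ⟦coefficient⟧ : ∀ j μ ν z → ⟦ coefficient j μ ν ⟧ * (T̄ (w ν) * z) ≈ κ (toℕ (position μ j)) * term z (weigh μ ν)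
  ⟦coefficient⟧ j μ ν z = begin
    ⟦ coefficient j μ ν ⟧ * (T̄ (w ν) * z)
      ≈⟨ *-cong (*-cong (*-cong (+-congˡ (-‿cong (*-congˡ (sym (X-toℕ (position μ j)))))) (⟦con-^⟧ A.p (Skew.ht μ ν ∸ 1))) (⟦con-^⟧ A.q (Skew.wd μ ν ∸ 1))) (T̄-w ν z) ⟩
    (κ (toℕ (position μ j)) * p′ ^ (Skew.ht μ ν ∸ 1) * q′ ^ (Skew.wd μ ν ∸ 1)) * W 0 (rows ν) z
      ≈⟨ trans (*-assoc _ _ _) (*-assoc _ _ _) ⟩
    κ (toℕ (position μ j)) * term z (weigh μ ν) ∎

  pieri : ∀ i μ {z} → (∀ {a} → k ≤ a → suc a < n → Fixed a z) → (∀ {a} → a < toℕ i → Fixed a z) →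
          T̄ (w μ) * (x (i ↑ˡ m) * z) ≈ valueAt z (D-basis (opposite i) μ)
  pieri i μ {z} fix fix′ = begin
    T̄ (w μ) * (x (i ↑ˡ m) * z)
      ≈⟨ T̄-w μ _ ⟩
    W 0 (rows μ) (x (i ↑ˡ m) * z)
      ≈⟨ W-cong 0 (rows μ) (*-congʳ (trans (sym (X-toℕ (i ↑ˡ m))) (reflexive (cong X (≡.trans (Fin.toℕ-↑ˡ i m) (≡.sym depth≡)))))) ⟩
    W 0 (rows μ) (X (depth j) * z)
      ≈⟨ W-X j (rows-fit μ) ℕ.≤-refl fix (λ lt → fix′ (≡.subst (_ <_) depth≡ lt)) ⟩
    X (depth j ℕ.+ lookup (rows μ) j) * W 0 (rows μ) z + κ (depth j ℕ.+ lookup (rows μ) j) * ∑ (map (term z) (ribbons j (rows μ)))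
      ≡⟨ cong (λ b → X b * W 0 (rows μ) z + κ b * ∑ (map (term z) (ribbons j (rows μ)))) (position-depth μ j) ⟨
    X pos * W 0 (rows μ) z + κ pos * ∑ (map (term z) (ribbons j (rows μ)))
      ≈⟨ +-cong (*-cong (X-toℕ _) (sym (T̄-w μ z))) (*-congˡ (trans (sym (∑-↭ (ribbons-↭ j μ))) (∑-map (weigh μ) νs))) ⟩
    x (position μ j) * (T̄ (w μ) * z) + κ pos * ∑ (map (term z ∘ weigh μ) νs)
      ≈⟨ +-congˡ (trans (*-∑ (κ pos) νs) (sym (∑-cong (λ ν → ⟦coefficient⟧ j μ ν z) νs))) ⟩
    x (position μ j) * (T̄ (w μ) * z) + ∑ (map (λ ν → ⟦ coefficient j μ ν ⟧ * (T̄ (w ν) * z)) νs)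
      ≈⟨ +-congˡ (∑-map (λ ν → coefficient j μ ν , ν) νs) ⟨
    valueAt z (D-basis j μ) ∎
    where
    j = opposite i
    pos = toℕ (position μ j)
    νs = filter (λ ν → Skew.ribbonWithHeadInRow? μ ν j) (partitions k m)
    depth≡ : depth j ≡ toℕ i
    depth≡ = ≡.trans (depth-opposite j) (cong toℕ (Fin.opposite-involutive i))

  valueAt-++ : ∀ z c c′ → valueAt z (c ++ c′) ≈ valueAt z c + valueAt z c′
  valueAt-++ z c c′ = trans (reflexive (cong ∑ (List.map-++ _ c c′))) (∑-++ (map _ c))

  valueAt-· : ∀ z g c → valueAt z (g · c) ≈ ⟦ g ⟧ * valueAt z c
  valueAt-· z g c = trans (∑-map _ c) (trans (∑-cong (λ _ → *-assoc _ _ _) c) (sym (*-∑ ⟦ g ⟧ c)))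

  valueAt-D : ∀ i {z} → (∀ {a} → k ≤ a → suc a < n → Fixed a z) → (∀ {a} → a < toℕ i → Fixed a z) →
              ∀ c → valueAt (x (i ↑ˡ m) * z) c ≈ valueAt z (D (opposite i) c)
  valueAt-D i fix fix′ []            = refl
  valueAt-D i {z} fix fix′ ((g , μ) ∷ c) = begin
    ⟦ g ⟧ * (T̄ (w μ) * (x (i ↑ˡ m) * z)) + valueAt (x (i ↑ˡ m) * z) c
      ≈⟨ +-cong (*-congˡ (pieri i μ fix fix′)) (valueAt-D i fix fix′ c) ⟩
    ⟦ g ⟧ * valueAt z (D-basis (opposite i) μ) + valueAt z (D (opposite i) c)
      ≈⟨ +-congʳ (valueAt-· z g (D-basis (opposite i) μ)) ⟨
    valueAt z (g · D-basis (opposite i) μ) + valueAt z (D (opposite i) c)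
      ≈⟨ valueAt-++ z (g · D-basis (opposite i) μ) _ ⟨
    valueAt z (D (opposite i) ((g , μ) ∷ c)) ∎

  monomial : List (Fin k) → Carrier
  monomial is = ∏ (map (λ i → x (i ↑ˡ m)) is)

  Fixed-monomial : ∀ {a} is → All (λ i → toℕ i ≢ a × toℕ i ≢ suc a) is → Fixed a Σⁿₖ → Fixed a (monomial is * Σⁿₖ)
  Fixed-monomial []       []                    fix = Fixed-resp (sym (*-identityˡ _)) fix
  Fixed-monomial {a} (i ∷ is) ((≢a , ≢sa) ∷ off) fix = Fixed-resp (sym (*-assoc _ _ _)) (Fixed-* x-S (Fixed-monomial is off fix))
    where
    X≈ : X (toℕ i) ≈ x (i ↑ˡ m)
    X≈ = trans (reflexive (cong X (≡.sym (Fin.toℕ-↑ˡ i m)))) (X-toℕ (i ↑ˡ m))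
    x-S : x (i ↑ˡ m) * S a ≈ S a * x (i ↑ˡ m)
    x-S = trans (*-congʳ (sym X≈)) (trans (sym (S-X ≢a ≢sa)) (*-congˡ X≈))

  -- Stated for every combination `c`, since `foldl` replaces its accumulator at each step.
  valueAt-foldl : ∀ is → AllPairs Fin._<_ is → ∀ c →
                  valueAt (monomial is * Σⁿₖ) c ≈ value (foldl (λ c i → D (opposite i) c) c is)
  valueAt-foldl []       []           c = ∑-cong (λ (g , ν) → *-congˡ (*-congˡ (*-identityˡ _))) c
  valueAt-foldl (i ∷ is) (i< ∷ pairs) c = begin
    valueAt (monomial (i ∷ is) * Σⁿₖ) c                 ≈⟨ ∑-cong (λ (g , ν) → *-congˡ (*-congˡ (*-assoc _ _ _))) c ⟩
    valueAt (x (i ↑ˡ m) * (monomial is * Σⁿₖ)) c        ≈⟨ valueAt-D i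
      (λ k≤a lt → Fixed-monomial is (All.universal (λ j → ℕ.<⇒≢ (ℕ.<-≤-trans (Fin.toℕ<n j) k≤a) , ℕ.<⇒≢ (ℕ.<-≤-trans (Fin.toℕ<n j) (ℕ.m≤n⇒m≤1+n k≤a))) is) (Fixed-Σ-right k≤a lt))
      -- The later indices exceed `i`, hence also a and a + 1, so S_a passes their variables; and a
      -- + 1 ≤ i < k makes S_a a generator of the left factor S_k.
      (λ a<i → Fixed-monomial is (All.map (λ i<j → ℕ.>⇒≢ (ℕ.<-trans a<i i<j) , ℕ.>⇒≢ (ℕ.≤-<-trans a<i i<j)) i<) (Fixed-Σ-left (ℕ.≤-<-trans a<i (Fin.toℕ<n i)))) c ⟩
    valueAt (monomial is * Σⁿₖ) (D (opposite i) c)      ≈⟨ valueAt-foldl is pairs (D (opposite i) c) ⟩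
    value (foldl (λ c i → D (opposite i) c) c (i ∷ is)) ∎

theorem5p3 : ∀ (k m : ℕ) (μ : Partition k m) (is : List (Fin k)) → Linked Fin._<_ is →
    let open Grassmannian k m in
    T̄ (w μ) * ∏ (map (λ i → x (i ↑ˡ m)) is) * Σⁿₖ
    ≈ value (foldl (λ c i → D (opposite i) c) (basis μ) is)
theorem5p3 k m μ is linked = begin
  T̄ (w μ) * monomial is * Σⁿₖ                         ≈⟨ *-assoc _ _ _ ⟩
  T̄ (w μ) * (monomial is * Σⁿₖ)                       ≈⟨ *-identityˡ _ ⟨
  1# * (T̄ (w μ) * (monomial is * Σⁿₖ))                ≈⟨ +-identityʳ _ ⟨
  valueAt (monomial is * Σⁿₖ) (basis μ)               ≈⟨ valueAt-foldl is (Linked⇒AllPairs Fin.<-trans linked) (basis μ) ⟩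
  value (foldl (λ c i → D (opposite i) c) (basis μ) is) ∎
  where
  open Grassmannian k m
  open GrassmannianHecke k m
  open import Relation.Binary.Reasoning.Setoid setoid
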